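{- Let $m\ge 3$ and $l\ge 1$ be integers. Let $C_m$ be the cycle $v_1v_2\dotsm v_mv_1$ and let $P_l$ be the path $v_{m+1}v_{m+2}\dotsm v_{m+l}$. Let $L(\mathrm{Tp}_{m,l})$ be the labeled graph on $v_1,\dots,v_{m+l}$ obtained from the disjoint union of $C_m$ and $P_l$ by adding the two edges $v_1v_{m+1}$ and $v_mv_{m+1}$. Then $L(\mathrm{Tp}_{m,l})$ is $(e)$-positive.
   Context: Let $G$ be a finite simple graph with vertices labeled $v_1,\dots,v_d$. Its chromatic symmetric function in noncommuting variables is $Y_G=\sum_\kappa x_{\kappa(v_1)}x_{\kappa(v_2)}\dotsm x_{\kappa(v_d)}$, where $x_1,x_2,\dots$ are noncommuting variables and the sum is over all proper colorings $\kappa\colon V(G)\to\{1,2,3,\dots\}$. Let $\Pi_d$ be the set of set partitions of $[d]=\{1,\dots,d\}$. For $\pi\in\Pi_d$, let $e_\pi=\sum_{(i_1,\dots,i_d)}x_{i_1}\dotsm x_{i_d}$, where the sum is over all sequences $(i_1,\dots,i_d)$ of positive integers such that $i_j\ne i_k$ whenever $j\neq k$ lie in the same block of $\pi$. The $e_\pi$, $\pi\in\Pi_d$, are linearly independent over $\mathbb{Q}$ and $Y_G$ is uniquely a rational linear combination $Y_G=\sum_{\sigma\in\Pi_d}c_\sigma e_\sigma$. The type $\lambda(\pi)$ is the integer partition of $d$ formed by the block sizes of $\pi$, and $b_\pi$ is the size of the block of $\pi$ containing $d$. Write $\pi\equiv\sigma$ if $\lambda(\pi)=\lambda(\sigma)$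 and $b_\pi=b_\sigma$; let $(\pi)$ be the equivalence class of $\pi$, and set $c_{(\pi)}=\sum_{\sigma\in(\pi)}c_\sigma$. The labeled graph $G$ is called $(e)$-positive if $c_{(\pi)}\ge 0$ for every equivalence class $(\pi)\subseteq\Pi_d$. Here $d=m+l$. The graph $L(\mathrm{Tp}_{m,l})$ is the line graph of the tadpole consisting of a cycle of length $m$ with a pendant path having $l$ edges attached at one vertex of the cycle. -}

module Defs where

open import Data.Bool.Base using (if_then_else_)
open import Data.Empty using (⊥)
open import Data.Fin.Base using (Fin; toℕ; fromℕ; splitAt)
import Data.Fin.Properties as Fin
open import Data.Fin.Subset using (Subset; _∈_; ∣_∣; inside; outside)
open import Data.Fin.Subset.Properties using (_∈?_)
open import Data.List.Base
  using (List; []; _∷_; map; filter; foldr; deduplicate; mapMaybe; cartesianProductWith)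
import Data.List.Properties as List
import Data.List.Sort.Base as Sort
import Data.List.Sort.InsertionSort as InsertionSort
open import Data.Maybe.Base using (Maybe; just; nothing)
open import Data.Nat.Base using (ℕ; zero; suc)
import Data.Nat.Base as ℕ
import Data.Nat.Properties as ℕ
open import Data.Product.Base using (_×_; _,_; ∃-syntax)
open import Data.Rational.Base using (ℚ; 0ℚ; 1ℚ; _+_; _*_; _≤_)
open import Data.Sum.Base using (_⊎_; inj₁; inj₂; swap; [_,_])
open import Data.Sum.Relation.Binary.Pointwise as ⊎ using (Pointwise)
open import Data.Vec.Base as Vec using (Vec; []; _∷_; lookup; toList)
import Data.Vec.Properties as Vec
import Data.Bool.Properties as Bool
open import Function.Base using (_∘_)
open import Relation.Binary.Core using (Rel)
open import Relation.Binary.Definitions using (Decidable; DecidableEquality; Symmetric; Irreflexive)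
open import Relation.Binary.PropositionalEquality using (_≡_; _≢_; refl; sym)
import Relation.Binary.Properties.DecTotalOrder as DecTotalOrder
open import Relation.Nullary using (Dec; yes; no; does; ¬?; _×-dec_; _⊎-dec_; _→-dec_)

------------------------------------------------------------------------
-- Labeled graphs

-- The vertices v₁, …, v_d are the elements of Fin d, v_{i+1} being the
-- element i; `label` recovers the subscript.

record Graph (d : ℕ) : Set₁ where
  field
    Adj    : Rel (Fin d) _
    irrefl : Irreflexive _≡_ Adj
    symm   : Symmetric Adj
    adj?   : Decidable Adj

open Graph public

label : ∀ {d} → Fin d → ℕ
label = suc ∘ toℕ

fromRel : ∀ {d} {R : Rel (Fin d) _} → Decidable R → Graph d
fromRel {R = R} R? = record
  { Adj    = λ u v → u ≢ v × (R u v ⊎ R v u)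
  ; irrefl = λ { u≡v (u≢v , _) → u≢v u≡v }
  ; symm   = λ { (u≢v , r) → (u≢v ∘ sym) , swap r }
  ; adj?   = λ u v → ¬? (u Fin.≟ v) ×-dec (R? u v ⊎-dec R? v u)
  }

infixr 5 _∪_ _⊕_

_∪_ : ∀ {d} → Graph d → Graph d → Graph d
G ∪ H = record
  { Adj    = λ u v → Adj G u v ⊎ Adj H u v
  ; irrefl = λ { u≡v → [ irrefl G u≡v , irrefl H u≡v ] }
  ; symm   = λ { (inj₁ a) → inj₁ (symm G a) ; (inj₂ a) → inj₂ (symm H a) }
  ; adj?   = λ u v → adj? G u v ⊎-dec adj? H u v
  }

-- Disjoint union; the vertices of the second graph are relabeled to
-- come after those of the first.

_⊕_ : ∀ {m l} → Graph m → Graph l → Graph (m ℕ.+ l)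
_⊕_ {m} G H = record
  { Adj    = λ u v → Pointwise (Adj G) (Adj H) (splitAt m u) (splitAt m v)
  ; irrefl = λ { {u} refl → irrefl′ (splitAt m u) }
  ; symm   = ⊎.⊎-symmetric (symm G) (symm H)
  ; adj?   = λ u v → ⊎.⊎-decidable (adj? G) (adj? H) (splitAt m u) (splitAt m v)
  }
  where
  irrefl′ : ∀ x → Pointwise (Adj G) (Adj H) x x → ⊥
  irrefl′ (inj₁ _) (Pointwise.inj₁ a) = irrefl G refl a
  irrefl′ (inj₂ _) (Pointwise.inj₂ a) = irrefl H refl a

-- The graph whose only edge is v_a v_b (for distinct a, b in 1, …, d).

edge : ∀ {d} → ℕ → ℕ → Graph d
edge a b = fromRel λ u v → (label u ℕ.≟ a) ×-dec (label v ℕ.≟ b)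

path : ∀ n → Graph n
path n = fromRel λ u v → suc (label u) ℕ.≟ label v

-- A cycle for n ≥ 3.

cycle : ∀ n → Graph n
cycle n = path n ∪ edge n 1

lineTadpole : ∀ m l → Graph (m ℕ.+ l)
lineTadpole m l = (cycle m ⊕ path l) ∪ edge 1 (m ℕ.+ 1) ∪ edge m (m ℕ.+ 1)

------------------------------------------------------------------------
-- Set partitions of [d]

-- A set partition is given by the map sending each element to the block
-- that contains it.  The proofs are irrelevant, so partitions with the
-- same blocks are propositionally equal.

IsPartition : ∀ {d} → Vec (Subset d) d → Set
IsPartition B =
  (∀ i → i ∈ lookup B i) ×
  (∀ i j → j ∈ lookup B i → lookup B j ≡ lookup B i)

record SetPartition (d : ℕ) : Set where
  constructor ⟨_,_⟩
  field
    blocksOf     : Vec (Subset d) d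
    .isPartition : IsPartition blocksOf

  block : Fin d → Subset d
  block = lookup blocksOf

open SetPartition public

_≟ˢ_ : ∀ {d} → DecidableEquality (Subset d)
_≟ˢ_ = Vec.≡-dec Bool._≟_

isPartition? : ∀ {d} (B : Vec (Subset d) d) → Dec (IsPartition B)
isPartition? B =
  Fin.all? (λ i → i ∈? lookup B i) ×-dec
  Fin.all? (λ i → Fin.all? λ j → (j ∈? lookup B i) →-dec (lookup B j ≟ˢ lookup B i))

vectors : ∀ {A : Set} → List A → ∀ n → List (Vec A n)
vectors xs zero    = [] ∷ []
vectors xs (suc n) = cartesianProductWith _∷_ xs (vectors xs n)

subsets : ∀ d → List (Subset d)
subsets = vectors (inside ∷ outside ∷ [])

-- The list of all set partitions of [d], without repetition.

Π : ∀ d → List (SetPartition d)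
Π d = mapMaybe toPartition (vectors (subsets d) d)
  where
  toPartition : Vec (Subset d) d → Maybe (SetPartition d)
  toPartition B with isPartition? B
  ... | yes p = just ⟨ B , p ⟩
  ... | no  _ = nothing

blocks : ∀ {d} → SetPartition d → List (Subset d)
blocks π = deduplicate _≟ˢ_ (toList (blocksOf π))

open Sort.SortingAlgorithm
  (InsertionSort.insertionSort (DecTotalOrder.≥-decTotalOrder ℕ.≤-decTotalOrder))
  using (sort)

-- The integer partition λ(π), as a weakly decreasing list.

type : ∀ {d} → SetPartition d → List ℕ
type π = sort (map ∣_∣ (blocks π))

-- b_π, the size of the block containing d (a dummy value when d = 0).

lastBlockSize : ∀ {d} → SetPartition d → ℕ
lastBlockSize {zero}  π = 0
lastBlockSize {suc n} π = ∣ block π (fromℕ n) ∣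

infix 4 _≋_ _≋?_

_≋_ : ∀ {d} → Rel (SetPartition d) _
π ≋ σ = type π ≡ type σ × lastBlockSize π ≡ lastBlockSize σ

_≋?_ : ∀ {d} → Decidable (_≋_ {d})
π ≋? σ = List.≡-dec ℕ._≟_ (type π) (type σ) ×-dec (lastBlockSize π ℕ.≟ lastBlockSize σ)

------------------------------------------------------------------------
-- Series in noncommuting variables

-- The word w stands for the monomial x_{w(1)} x_{w(2)} ⋯ x_{w(d)}, the
-- variables (and the colors) being indexed by ℕ, and a homogeneous
-- series of degree d is identified with its coefficient function.

Word : ℕ → Set
Word d = Fin d → ℕ

Series : ℕ → Set
Series d = Word d → ℚ

-- The sum of the monomials w satisfying P, each taken once.

Σ-monomials : ∀ {d} {P : Word d → Set} → (∀ w → Dec (P w)) → Series d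
Σ-monomials P? w = if does (P? w) then 1ℚ else 0ℚ

-- A coloring κ contributes exactly the monomial given by the word κ, so
-- distinct colorings contribute distinct monomials.

Proper : ∀ {d} → Graph d → Word d → Set
Proper G κ = ∀ u v → Adj G u v → κ u ≢ κ v

proper? : ∀ {d} (G : Graph d) κ → Dec (Proper G κ)
proper? G κ = Fin.all? λ u → Fin.all? λ v → adj? G u v →-dec ¬? (κ u ℕ.≟ κ v)

Y : ∀ {d} → Graph d → Series d
Y G = Σ-monomials (proper? G)

DistinctOnBlocks : ∀ {d} → SetPartition d → Word d → Set
DistinctOnBlocks π w = ∀ j k → j ≢ k → k ∈ block π j → w j ≢ w k

distinctOnBlocks? : ∀ {d} (π : SetPartition d) w → Dec (DistinctOnBlocks π w)
distinctOnBlocks? π w = Fin.all? λ j → Fin.all? λ k →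
  ¬? (j Fin.≟ k) →-dec ((k ∈? block π j) →-dec ¬? (w j ℕ.≟ w k))

e : ∀ {d} → SetPartition d → Series d
e π = Σ-monomials (distinctOnBlocks? π)

------------------------------------------------------------------------
-- (e)-positivity

Σ[_] : ∀ {A : Set} → List A → (A → ℚ) → ℚ
Σ[ xs ] f = foldr _+_ 0ℚ (map f xs)

IsExpansion : ∀ {d} → Series d → (SetPartition d → ℚ) → Set
IsExpansion {d} F c = ∀ w → F w ≡ Σ[ Π d ] λ σ → c σ * e σ w

-- c_(π), the sum of the coefficients over the equivalence class of π.

classSum : ∀ {d} → (SetPartition d → ℚ) → SetPartition d → ℚ
classSum {d} c π = Σ[ filter (π ≋?_) (Π d) ] c

-- The e_π form a basis, so the coefficient family c is the only one that
-- expands Y G.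

EPositive : ∀ {d} → Graph d → Set
EPositive G = ∃[ c ] IsExpansion (Y G) c × (∀ π → 0ℚ ≤ classSum c π)

-- Every function of a word that depends only on which letters coincide is
-- in the span of the e_π, so two such functions that differ by a relabeling
-- of the positions fixing the last one have the same class sums.  Write E_b
-- for a basis element whose last block has size b, and F↑ for F with its
-- last letter duplicated.  Averaging over the last block gives, up to such
-- relabelings, E_b↑ = (E_b·e₁ − E_{b+1}) / b, where E_b·e₁ has a new singleton
-- last block.  Deletion–contraction then expands the path P_n, the cycle C_n,
-- and the line graph of the tadpole,
--   P_{n+1} = P_n·e₁ − P_n↑,   C_{n+1} = P_{n+1} − C_n↑,
--   L(Tp_{n,1}) = C_n·e₁ − 2 C_n↑,
-- where the contracted edges were moved to the last position by a reflection
-- of the cycle.  By induction, if P_n = Σ c E_b with c ≥ 0 then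
-- C_n = Σ (b − 1) c E_b, whence
--   L(Tp_{n,1}) = Σ c (b − 1)/b ((b − 2) E_b·e₁ + 2 E_{b+1}),
-- and appending the rest of the path preserves positivity.

module Submission where

open import Defs
open import Data.Bool.Base using (true; false; if_then_else_)
import Data.Bool.Properties as Bool
open import Data.Fin.Base using (Fin; zero; suc; toℕ; fromℕ; fromℕ<; splitAt; _↑ˡ_; _↑ʳ_)
import Data.Fin.Properties as Fin
open import Data.Fin.Subset using (Subset; ∣_∣; inside) renaming (_∈_ to _∈ˢ_)
open import Data.List.Base using (List; []; _∷_; [_]; _++_; map; filter; length; concat; downFrom; mapMaybe; cartesianProductWith; allFin)
import Data.List.Base as List
import Data.List.Properties as List
open import Data.List.Membership.Propositional using (_∈_)
open import Data.List.Membership.Propositional.Properties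
open import Data.List.Membership.Propositional.Properties.WithK using (unique∧set⇒bag)
open import Data.List.Relation.Binary.BagAndSetEquality using (∼bag⇒↭)
open import Data.List.Relation.Binary.Permutation.Propositional
  using (_↭_; prep; swap; ↭-refl; ↭-reflexive; ↭-sym; ↭-trans; ↭⇒↭ₛ; module PermutationReasoning)
import Data.List.Relation.Binary.Permutation.Propositional as Perm
import Data.List.Relation.Binary.Permutation.Propositional.Properties as ↭
import Data.List.Relation.Binary.Permutation.Setoid.Properties as Permₛ
open import Data.List.Relation.Binary.Pointwise using (Pointwise-≡⇒≡)
open import Data.List.Relation.Unary.All as All using (All; []; _∷_)
import Data.List.Relation.Unary.All.Properties as All
open import Data.List.Relation.Unary.AllPairs using ([]; _∷_)
open import Data.List.Relation.Unary.Any as Any using (Any; here; there)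
import Data.List.Relation.Unary.Sorted.TotalOrder.Properties as Sorted
open import Data.List.Relation.Unary.Unique.Propositional using (Unique)
import Data.List.Relation.Unary.Unique.Propositional.Properties as Unique
import Data.List.Relation.Unary.Unique.DecPropositional.Properties as DecUnique
import Data.List.Sort.Base as Sort
import Data.List.Sort.InsertionSort as InsertionSort
open import Data.Maybe.Base using (Maybe; just; nothing; maybe)
open import Data.Nat.Base using (ℕ; zero; suc; s≤s; z≤n; _≥_)
import Data.Nat.Base as ℕ
import Data.Nat.Properties as ℕ
open import Data.List.Membership.DecPropositional ℕ._≟_ using (_∈?_)
open import Data.List.Relation.Unary.Unique.DecPropositional ℕ._≟_ using (unique?)
open import Data.Product.Base using (_×_; _,_; ∃-syntax; proj₁; proj₂)
open import Data.Rational.Base using (ℚ; 0ℚ; 1ℚ; _+_; _-_; _*_; -_; _≤_; 1/_; Positive; NonNegative; nonNegative)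
import Data.Rational.Properties as ℚ
open import Data.Rational.Solver using (module +-*-Solver)
open import Data.Sum.Base using (_⊎_; inj₁; inj₂; [_,_]′)
open import Data.Sum.Relation.Binary.Pointwise using (Pointwise; inj₁; inj₂)
open import Data.Vec.Base using (Vec; []; _∷_; lookup; tabulate; toList)
import Data.Vec.Properties as Vec
open import Function.Base using (_∘_; id)
open import Function.Bundles using (mk⇔)
import Relation.Binary.Properties.DecTotalOrder as DecTotalOrder
open import Relation.Binary.PropositionalEquality hiding ([_])
open import Relation.Nullary using (¬_; Dec; yes; no; does; ¬?; _×-dec_)
open import Relation.Nullary.Decidable using (map′; does-⇔; dec-true; dec-false)
open import Relation.Nullary.Negation using (contradiction; contradiction-irr)
open +-*-Solver using (solve; _:=_; _:+_; _:*_; _:-_; :-_; con)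

-- Finite sums

-- Class sums are linear in a chosen expansion, so a congruence of functions is turned into an
-- expansion of their difference whose class sums all vanish. This asks that every function to which
-- a relabeling is applied lie in the span of the e_σ. Contraction produces indicators that the
-- letters on a block agree, whereas e_σ tests that they differ. Möbius inversion in the partition
-- lattice passes from the first kind to the second: the leading coefficient (-1)ⁿ n! is nonzero, so
-- the relation can be solved for the agreement indicator. The last position must stay fixed because
-- contraction duplicates the last letter, and duplication commutes with a relabeling that moves
-- neither copy.

Σ-cong : ∀ {A : Set} (xs : List A) {f g : A → ℚ} → (∀ x → f x ≡ g x) → Σ[ xs ] f ≡ Σ[ xs ] g
Σ-cong []       f≗g = refl
Σ-cong (x ∷ xs) f≗g = cong₂ _+_ (f≗g x) (Σ-cong xs f≗g)

Σ-0 : ∀ {A : Set} (xs : List A) {f : A → ℚ} → (∀ x → f x ≡ 0ℚ) → Σ[ xs ] f ≡ 0ℚ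
Σ-0 []       f≗0 = refl
Σ-0 (x ∷ xs) f≗0 = cong₂ _+_ (f≗0 x) (Σ-0 xs f≗0)

Σ-+ : ∀ {A : Set} (xs : List A) (f g : A → ℚ) → Σ[ xs ] (λ x → f x + g x) ≡ Σ[ xs ] f + Σ[ xs ] g
Σ-+ []       f g = refl
Σ-+ (x ∷ xs) f g rewrite Σ-+ xs f g =
  solve 4 (λ a b c d → (a :+ b) :+ (c :+ d) := (a :+ c) :+ (b :+ d)) refl (f x) (g x) (Σ[ xs ] f) (Σ[ xs ] g)

Σ-*ˡ : ∀ {A : Set} (xs : List A) a (f : A → ℚ) → Σ[ xs ] (λ x → a * f x) ≡ a * Σ[ xs ] f
Σ-*ˡ []       a f = sym (ℚ.*-zeroʳ a)
Σ-*ˡ (x ∷ xs) a f rewrite Σ-*ˡ xs a f = sym (ℚ.*-distribˡ-+ a (f x) (Σ[ xs ] f))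

Σ-++ : ∀ {A : Set} (xs ys : List A) (f : A → ℚ) → Σ[ xs ++ ys ] f ≡ Σ[ xs ] f + Σ[ ys ] f
Σ-++ []       ys f = sym (ℚ.+-identityˡ _)
Σ-++ (x ∷ xs) ys f rewrite Σ-++ xs ys f = sym (ℚ.+-assoc (f x) _ _)

Σ-map : ∀ {A B : Set} (xs : List A) (g : A → B) (f : B → ℚ) → Σ[ map g xs ] f ≡ Σ[ xs ] (f ∘ g)
Σ-map []       g f = refl
Σ-map (x ∷ xs) g f = cong (f (g x) +_) (Σ-map xs g f)

Σ-cartesianProductWith : ∀ {A B C : Set} (g : A → B → C) xs ys (f : C → ℚ) →
  Σ[ cartesianProductWith g xs ys ] f ≡ Σ[ xs ] (λ x → Σ[ ys ] (f ∘ g x))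
Σ-cartesianProductWith g []       ys f = refl
Σ-cartesianProductWith g (x ∷ xs) ys f =
  trans (Σ-++ (map (g x) ys) _ f) (cong₂ _+_ (Σ-map ys (g x) f) (Σ-cartesianProductWith g xs ys f))

Σ-mapMaybe : ∀ {A B : Set} (g : A → Maybe B) xs (f : B → ℚ) →
  Σ[ mapMaybe g xs ] f ≡ Σ[ xs ] (maybe f 0ℚ ∘ g)
Σ-mapMaybe g []       f = refl
Σ-mapMaybe g (x ∷ xs) f with g x
... | just y  = cong (f y +_) (Σ-mapMaybe g xs f)
... | nothing = trans (Σ-mapMaybe g xs f) (sym (ℚ.+-identityˡ _))

Σ-filter : ∀ {A : Set} {P : A → Set} (P? : ∀ x → Dec (P x)) xs (f : A → ℚ) →
  Σ[ filter P? xs ] f ≡ Σ[ xs ] (λ x → if does (P? x) then f x else 0ℚ)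
Σ-filter P? []       f = refl
Σ-filter P? (x ∷ xs) f with does (P? x)
... | true  = cong (f x +_) (Σ-filter P? xs f)
... | false = trans (Σ-filter P? xs f) (sym (ℚ.+-identityˡ _))

-- A list enumerates a type without repetition precisely when sums over it
-- pick out the only nonvanishing summand.

Enumerates : {A : Set} → List A → Set
Enumerates {A} xs = ∀ u (h : A → ℚ) → (∀ v → v ≢ u → h v ≡ 0ℚ) → Σ[ xs ] h ≡ h u

vectors-enumerates : ∀ {A : Set} {xs : List A} → Enumerates xs → ∀ n → Enumerates (vectors xs n)
vectors-enumerates en zero [] h h≡0 = ℚ.+-identityʳ _
vectors-enumerates {xs = xs} en (suc n) (a ∷ u) h h≡0 = begin
  Σ[ vectors xs (suc n) ] h                            ≡⟨ Σ-cartesianProductWith _∷_ xs (vectors xs n) h ⟩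
  Σ[ xs ] (λ x → Σ[ vectors xs n ] (h ∘ (x ∷_)))       ≡⟨ en a _ (λ v v≢a → Σ-0 (vectors xs n) λ w → h≡0 (v ∷ w) (v≢a ∘ Vec.∷-injectiveˡ)) ⟩
  Σ[ vectors xs n ] (h ∘ (a ∷_))                       ≡⟨ vectors-enumerates en n u _ (λ v v≢u → h≡0 (a ∷ v) (v≢u ∘ Vec.∷-injectiveʳ)) ⟩
  h (a ∷ u)                                            ∎
  where open ≡-Reasoning

subsets-enumerates : ∀ d → Enumerates (subsets d)
subsets-enumerates = vectors-enumerates {xs = true ∷ false ∷ []} λ
  { true  h h≡0 → trans (cong (λ z → h true + (z + 0ℚ)) (h≡0 false λ ())) (ℚ.+-identityʳ _)
  ; false h h≡0 → trans (cong (_+ (h false + 0ℚ)) (h≡0 true λ ())) (trans (ℚ.+-identityˡ _) (ℚ.+-identityʳ _)) }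

mapMaybe-enumerates : ∀ {A B : Set} {xs : List A} (f : A → Maybe B) (r : B → A) →
  (∀ b → f (r b) ≡ just b) → (∀ {a b} → f a ≡ just b → a ≡ r b) →
  Enumerates xs → Enumerates (mapMaybe f xs)
mapMaybe-enumerates {xs = xs} f r fr≡ f⁻ en u h h≡0 = begin
  Σ[ mapMaybe f xs ] h       ≡⟨ Σ-mapMaybe f xs h ⟩
  Σ[ xs ] (maybe h 0ℚ ∘ f)   ≡⟨ en (r u) _ vanish ⟩
  maybe h 0ℚ (f (r u))       ≡⟨ cong (maybe h 0ℚ) (fr≡ u) ⟩
  h u                        ∎
  where
  open ≡-Reasoning
  vanish : ∀ a → a ≢ r u → maybe h 0ℚ (f a) ≡ 0ℚ
  vanish a a≢ru with f a in eq
  ... | nothing = refl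
  ... | just b  = h≡0 b λ { refl → a≢ru (f⁻ eq) }

partition-≡ : ∀ {d} {π σ : SetPartition d} → blocksOf π ≡ blocksOf σ → π ≡ σ
partition-≡ {π = ⟨ _ , _ ⟩} {⟨ _ , _ ⟩} refl = refl

Π-enumerates : ∀ d → Enumerates (Π d)
Π-enumerates d = mapMaybe-enumerates {xs = vectors (subsets d) d} (proj₁ mapMaybe-form) blocksOf complete sound
  (vectors-enumerates {xs = subsets d} (subsets-enumerates d) d)
  where
  -- `toPartition` is local to `Π`; solving the hole against `refl` makes it accessible as the first
  -- component.
  mapMaybe-form : ∃[ f ] Π d ≡ mapMaybe f (vectors (subsets d) d)
  mapMaybe-form = _ , refl

  complete : ∀ π → proj₁ mapMaybe-form (blocksOf π) ≡ just π
  complete ⟨ B , p ⟩ with isPartition? B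
  ... | yes _ = refl
  ... | no ¬p = contradiction-irr p ¬p

  sound : ∀ {B π} → proj₁ mapMaybe-form B ≡ just π → B ≡ blocksOf π
  sound {B} eq with isPartition? B
  sound refl | yes _ = refl
  sound ()   | no _

-- Expansions in the basis e together with their class sums

_≟ᵖ_ : ∀ {d} (π σ : SetPartition d) → Dec (π ≡ σ)
π ≟ᵖ σ with Vec.≡-dec _≟ˢ_ (blocksOf π) (blocksOf σ)
... | yes p = yes (partition-≡ p)
... | no ¬p = no (¬p ∘ cong blocksOf)

indicator : {P : Set} → Dec P → ℚ
indicator P? = if does P? then 1ℚ else 0ℚ

indicator-yes : ∀ {P : Set} (P? : Dec P) → P → indicator P? ≡ 1ℚ
indicator-yes P? p = cong (if_then 1ℚ else 0ℚ) (dec-true P? p)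

indicator-no : ∀ {P : Set} (P? : Dec P) → ¬ P → indicator P? ≡ 0ℚ
indicator-no P? ¬p = cong (if_then 1ℚ else 0ℚ) (dec-false P? ¬p)

indicator-⇔ : ∀ {P Q : Set} (P? : Dec P) (Q? : Dec Q) → (P → Q) → (Q → P) → indicator P? ≡ indicator Q?
indicator-⇔ (yes p) Q? to from = sym (indicator-yes Q? (to p))
indicator-⇔ (no ¬p) Q? to from = sym (indicator-no Q? (¬p ∘ from))

-- Recording the class sums together with the existence of coefficients lets expansions be added and
-- scaled without comparing coefficients.
Expands : ∀ {d} → Series d → (SetPartition d → ℚ) → Set
Expands F φ = ∃[ c ] IsExpansion F c × (∀ π → classSum c π ≡ φ π)

classSum-Σ : ∀ {d} (c : SetPartition d → ℚ) π →
  classSum c π ≡ Σ[ Π d ] (λ σ → indicator (π ≋? σ) * c σ)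
classSum-Σ {d} c π = trans (Σ-filter (π ≋?_) (Π d) c) (Σ-cong (Π d) pointwise)
  where
  pointwise : ∀ σ → (if does (π ≋? σ) then c σ else 0ℚ) ≡ indicator (π ≋? σ) * c σ
  pointwise σ with does (π ≋? σ)
  ... | true  = sym (ℚ.*-identityˡ _)
  ... | false = sym (ℚ.*-zeroˡ (c σ))

Expands-cong : ∀ {d} {F G : Series d} {φ ψ : SetPartition d → ℚ} →
  (∀ w → F w ≡ G w) → (∀ π → φ π ≡ ψ π) → Expands F φ → Expands G ψ
Expands-cong F≗G φ≗ψ (c , exp , cls) =
  c , (λ w → trans (sym (F≗G w)) (exp w)) , λ π → trans (cls π) (φ≗ψ π)

Expands-0 : ∀ {d} → Expands {d} (λ _ → 0ℚ) (λ _ → 0ℚ)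
Expands-0 {d} = (λ _ → 0ℚ) ,
  (λ w → sym (Σ-0 (Π d) λ σ → ℚ.*-zeroˡ (e σ w))) ,
  (λ π → Σ-0 (filter (π ≋?_) (Π d)) λ _ → refl)

Expands-e : ∀ {d} (σ : SetPartition d) → Expands (e σ) (λ π → indicator (π ≋? σ))
Expands-e {d} σ = c , exp , cls
  where
  c : SetPartition d → ℚ
  c π = indicator (π ≟ᵖ σ)

  exp : IsExpansion (e σ) c
  exp w = sym (trans
    (Π-enumerates d σ _ λ π π≢σ → trans (cong (_* e π w) (indicator-no (π ≟ᵖ σ) π≢σ)) (ℚ.*-zeroˡ (e π w)))
    (trans (cong (_* e σ w) (indicator-yes (σ ≟ᵖ σ) refl)) (ℚ.*-identityˡ _)))

  cls : ∀ π → classSum c π ≡ indicator (π ≋? σ)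
  cls π = trans (classSum-Σ c π) (trans
    (Π-enumerates d σ _ λ ρ ρ≢σ → trans (cong (indicator (π ≋? ρ) *_) (indicator-no (ρ ≟ᵖ σ) ρ≢σ)) (ℚ.*-zeroʳ (indicator (π ≋? ρ))))
    (trans (cong (indicator (π ≋? σ) *_) (indicator-yes (σ ≟ᵖ σ) refl)) (ℚ.*-identityʳ _)))

Expands-+ : ∀ {d} {F G : Series d} {φ ψ : SetPartition d → ℚ} →
  Expands F φ → Expands G ψ → Expands (λ w → F w + G w) (λ π → φ π + ψ π)
Expands-+ {d} (c , exp , cls) (c′ , exp′ , cls′) = (λ σ → c σ + c′ σ) ,
  (λ w → trans (cong₂ _+_ (exp w) (exp′ w))
    (trans (sym (Σ-+ (Π d) _ _)) (Σ-cong (Π d) λ σ → sym (ℚ.*-distribʳ-+ (e σ w) (c σ) (c′ σ))))) ,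
  (λ π → trans (Σ-+ (filter (π ≋?_) (Π d)) c c′) (cong₂ _+_ (cls π) (cls′ π)))

Expands-* : ∀ {d} a {F : Series d} {φ : SetPartition d → ℚ} →
  Expands F φ → Expands (λ w → a * F w) (λ π → a * φ π)
Expands-* {d} a (c , exp , cls) = (λ σ → a * c σ) ,
  (λ w → trans (cong (a *_) (exp w))
    (trans (sym (Σ-*ˡ (Π d) a _)) (Σ-cong (Π d) λ σ → sym (ℚ.*-assoc a (c σ) (e σ w))))) ,
  (λ π → trans (Σ-*ˡ (filter (π ≋?_) (Π d)) a c) (cong (a *_) (cls π)))

-- Relabeling by an involution

Involutive : {A : Set} → (A → A) → Set
Involutive t = ∀ x → t (t x) ≡ x

involutive⇒injective : ∀ {A : Set} {t : A → A} → Involutive t → ∀ {x y} → t x ≡ t y → x ≡ y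
involutive⇒injective {t = t} inv {x} {y} eq = trans (sym (inv x)) (trans (cong t eq) (inv y))

map-involution-↭ : ∀ {A : Set} {t : A → A} → Involutive t → ∀ {xs} →
  Unique xs → (∀ {x} → x ∈ xs → t x ∈ xs) → map t xs ↭ xs
map-involution-↭ {t = t} inv {xs} u closed =
  ∼bag⇒↭ (unique∧set⇒bag (Unique.map⁺ (involutive⇒injective inv) u) u (mk⇔ to from))
  where
  to : ∀ {z} → z ∈ map t xs → z ∈ xs
  to z∈ with ∈-map⁻ t z∈
  ... | x , x∈ , refl = closed x∈

  from : ∀ {z} → z ∈ xs → z ∈ map t xs
  from {z} z∈ = subst (_∈ map t xs) (inv z) (∈-map⁺ t (closed z∈))

toList-lookup : ∀ {A : Set} {n} (v : Vec A n) → toList v ≡ map (lookup v) (allFin n)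
toList-lookup v = trans (go v) (sym (List.map-tabulate id (lookup v)))
  where
  go : ∀ {A : Set} {n} (v : Vec A n) → toList v ≡ List.tabulate (lookup v)
  go []      = refl
  go (x ∷ v) = cong (x ∷_) (go v)

∣∣-toList : ∀ {d} (p : Subset d) → ∣ p ∣ ≡ length (filter (Bool._≟ inside) (toList p))
∣∣-toList []          = refl
∣∣-toList (true  ∷ p) = cong suc (∣∣-toList p)
∣∣-toList (false ∷ p) = ∣∣-toList p

type-↭ : ∀ {d} {π σ : SetPartition d} → map ∣_∣ (blocks π) ↭ map ∣_∣ (blocks σ) → type π ≡ type σ
type-↭ {π = π} {σ} p = Pointwise-≡⇒≡ (Sorted.↗↭↗⇒≋ O (sort-↗ xs) (sort-↗ ys)
  (↭⇒↭ₛ (↭-trans (sort-↭ xs) (↭-trans p (↭-sym (sort-↭ ys))))))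
  where
  xs = map ∣_∣ (blocks π)
  ys = map ∣_∣ (blocks σ)
  O = DecTotalOrder.≥-totalOrder ℕ.≤-decTotalOrder
  open Sort.SortingAlgorithm (InsertionSort.insertionSort (DecTotalOrder.≥-decTotalOrder ℕ.≤-decTotalOrder))

module Relabel {d} (t : Fin d → Fin d) (inv : Involutive t) where

  -- The formula is the preimage under `t`, which is also the image because `t` is its own inverse.
  image : Subset d → Subset d
  image p = tabulate (lookup p ∘ t)

  lookup-image : ∀ p j → lookup (image p) j ≡ lookup p (t j)
  lookup-image p j = Vec.lookup∘tabulate _ j

  ∈-image⁺ : ∀ {p j} → t j ∈ˢ p → j ∈ˢ image p
  ∈-image⁺ {p} {j} tj∈p = Vec.lookup⇒[]= j _ (trans (lookup-image p j) (Vec.[]=⇒lookup tj∈p))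

  ∈-image⁻ : ∀ {p j} → j ∈ˢ image p → t j ∈ˢ p
  ∈-image⁻ {p} {j} j∈ = Vec.lookup⇒[]= (t j) _ (trans (sym (lookup-image p j)) (Vec.[]=⇒lookup j∈))

  image-involutive : Involutive image
  image-involutive p = trans
    (Vec.tabulate-cong λ j → trans (lookup-image p (t j)) (cong (lookup p) (inv j)))
    (Vec.tabulate∘lookup p)

  ∣image∣ : ∀ p → ∣ image p ∣ ≡ ∣ p ∣
  ∣image∣ p = begin
    ∣ image p ∣                                             ≡⟨ ∣∣-toList (image p) ⟩
    length (filter (Bool._≟ inside) (toList (image p)))     ≡⟨ ↭.↭-length (↭.filter-↭ (Bool._≟ inside) toList-image) ⟩
    length (filter (Bool._≟ inside) (toList p))             ≡⟨ ∣∣-toList p ⟨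
    ∣ p ∣                                                   ∎
    where
    open ≡-Reasoning
    toList-image : toList (image p) ↭ toList p
    toList-image = subst₂ _↭_
      (trans (sym (List.map-∘ (allFin d))) (trans (List.map-cong (λ j → sym (lookup-image p j)) (allFin d)) (sym (toList-lookup (image p)))))
      (sym (toList-lookup p))
      (↭.map⁺ (lookup p) (map-involution-↭ inv (Unique.allFin⁺ d) λ _ → ∈-allFin _))

  relabel : SetPartition d → SetPartition d
  relabel π@(⟨ _ , isPart ⟩) = ⟨ B , partition isPart ⟩
    where
    B = tabulate λ i → image (block π (t i))

    lookup-B : ∀ i → lookup B i ≡ image (block π (t i))
    lookup-B = Vec.lookup∘tabulate _

    partition : IsPartition (blocksOf π) → IsPartition B
    partition (refl-π , eq-π) =
      (λ i → subst (i ∈ˢ_) (sym (lookup-B i)) (∈-image⁺ (refl-π (t i)))) ,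
      (λ i j j∈ → trans (lookup-B j) (trans
        (cong image (eq-π (t i) (t j) (∈-image⁻ (subst (j ∈ˢ_) (lookup-B i) j∈))))
        (sym (lookup-B i))))

  block-relabel : ∀ π i → block (relabel π) i ≡ image (block π (t i))
  block-relabel π = Vec.lookup∘tabulate _

  e-relabel : ∀ π w → e (relabel π) w ≡ e π (w ∘ t)
  e-relabel π w = indicator-⇔ (distinctOnBlocks? (relabel π) w) (distinctOnBlocks? π (w ∘ t))
    (λ p j k j≢k k∈ → p (t j) (t k) (j≢k ∘ involutive⇒injective inv)
      (subst (t k ∈ˢ_) (sym (block-relabel π (t j)))
        (∈-image⁺ (subst₂ _∈ˢ_ (sym (inv k)) (cong (block π) (sym (inv j))) k∈))))
    (λ p j k j≢k k∈ wj≡wk → p (t j) (t k) (j≢k ∘ involutive⇒injective inv)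
      (∈-image⁻ (subst (k ∈ˢ_) (block-relabel π j) k∈))
      (trans (cong w (inv j)) (trans wj≡wk (cong w (sym (inv k))))))

  -- Deduplication keeps an order of occurrence that relabeling disturbs, so the lists agree only up
  -- to permutation. Both are free of repetition, hence equality of their underlying sets suffices.
  blocks-relabel : ∀ π → blocks (relabel π) ↭ map image (blocks π)
  blocks-relabel π = ∼bag⇒↭ (unique∧set⇒bag
    (DecUnique.deduplicate-! _≟ˢ_ (toList (blocksOf (relabel π))))
    (Unique.map⁺ (involutive⇒injective image-involutive) (DecUnique.deduplicate-! _≟ˢ_ (toList (blocksOf π))))
    (mk⇔ to from))
    where
    block∈blocks : ∀ π i → block π i ∈ blocks π
    block∈blocks π i = ∈-deduplicate⁺ _≟ˢ_
      (subst (block π i ∈_) (sym (toList-lookup (blocksOf π))) (∈-map⁺ (block π) (∈-allFin i)))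

    blocks⁻ : ∀ π {z} → z ∈ blocks π → ∃[ i ] z ≡ block π i
    blocks⁻ π {z} z∈ with ∈-map⁻ (block π) (subst (z ∈_) (toList-lookup (blocksOf π)) (∈-deduplicate⁻ _≟ˢ_ (toList (blocksOf π)) z∈))
    ... | i , _ , eq = i , eq

    to : ∀ {z} → z ∈ blocks (relabel π) → z ∈ map image (blocks π)
    to z∈ with blocks⁻ (relabel π) z∈
    ... | i , refl = subst (_∈ map image (blocks π)) (sym (block-relabel π i)) (∈-map⁺ image (block∈blocks π (t i)))

    from : ∀ {z} → z ∈ map image (blocks π) → z ∈ blocks (relabel π)
    from z∈ with ∈-map⁻ image z∈
    ... | p , p∈ , refl with blocks⁻ π p∈
    ... | i , refl = subst (_∈ blocks (relabel π))
      (trans (block-relabel π (t i)) (cong (image ∘ block π) (inv i))) (block∈blocks (relabel π) (t i))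

  type-relabel : ∀ π → type (relabel π) ≡ type π
  type-relabel π = type-↭ {π = relabel π} {π} (begin
    map ∣_∣ (blocks (relabel π))         ↭⟨ ↭.map⁺ ∣_∣ (blocks-relabel π) ⟩
    map ∣_∣ (map image (blocks π))       ≡⟨ List.map-∘ (blocks π) ⟨
    map (∣_∣ ∘ image) (blocks π)         ≡⟨ List.map-cong ∣image∣ (blocks π) ⟩
    map ∣_∣ (blocks π)                   ∎)
    where open PermutationReasoning

relabel-≋ : ∀ {n} (t : Fin (suc n) → Fin (suc n)) (inv : Involutive t) → t (fromℕ n) ≡ fromℕ n →
  ∀ π → let open Relabel t inv in relabel π ≋ π
relabel-≋ {n} t inv fix π = type-relabel π ,
  trans (cong ∣_∣ (block-relabel π (fromℕ n))) (trans (∣image∣ (block π (t (fromℕ n)))) (cong (∣_∣ ∘ block π) fix))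
  where open Relabel t inv

-- Truth values in ℚ

-- Tying a rational to the proposition it tests reduces an identity between products of indicators
-- to an equivalence of propositions, via `Ind-≡`.
data Ind (P : Set) : ℚ → Set where
  holds : P → Ind P 1ℚ
  fails : ¬ P → Ind P 0ℚ

ind : ∀ {P} (P? : Dec P) → Ind P (indicator P?)
ind (yes p) = holds p
ind (no ¬p) = fails ¬p

Ind-* : ∀ {P Q a b} → Ind P a → Ind Q b → Ind (P × Q) (a * b)
Ind-* (holds p) (holds q) = holds (p , q)
Ind-* (holds p) (fails q) = fails (q ∘ proj₂)
Ind-* (fails p) (holds q) = fails (p ∘ proj₁)
Ind-* (fails p) (fails q) = fails (p ∘ proj₁)

Ind-¬ : ∀ {P a} → Ind P a → Ind (¬ P) (1ℚ + - a)
Ind-¬ (holds p) = fails λ ¬p → ¬p p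
Ind-¬ (fails p) = holds p

Ind-≡ : ∀ {P Q a b} → (P → Q) → (Q → P) → Ind P a → Ind Q b → a ≡ b
Ind-≡ to from (holds p) (holds q) = refl
Ind-≡ to from (holds p) (fails q) = contradiction (to p) q
Ind-≡ to from (fails p) (holds q) = contradiction (from q) p
Ind-≡ to from (fails p) (fails q) = refl

-- A series of degree d is treated as a function of infinite words that
-- depends on the letters in positions 0, …, d − 1 only; this avoids all
-- arithmetic on Fin.

Fn : Set
Fn = (ℕ → ℕ) → ℚ

δ : ℕ → ℕ → Fn
δ i j w = indicator (w i ℕ.≟ w j)

distinct : List ℕ → Fn
distinct S w = indicator (unique? (map w S))

AllEqual : (ℕ → ℕ) → List ℕ → Set
AllEqual w S = ∀ i j → i ∈ S → j ∈ S → w i ≡ w j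

allEqual? : ∀ w S → Dec (AllEqual w S)
allEqual? w S = map′
  (λ a i j i∈ j∈ → All.lookup (All.lookup a i∈) j∈)
  (λ a → All.tabulate λ i∈ → All.tabulate λ j∈ → a _ _ i∈ j∈)
  (All.all? (λ i → All.all? (λ j → w i ℕ.≟ w j) S) S)

equal : List ℕ → Fn
equal S w = indicator (allEqual? w S)

Unique-map-↭ : ∀ (w : ℕ → ℕ) {S T} → S ↭ T → Unique (map w S) → Unique (map w T)
Unique-map-↭ w p = Permₛ.Unique-resp-↭ (setoid ℕ) (↭⇒↭ₛ (↭.map⁺ w p))

distinct-↭ : ∀ {S T} → S ↭ T → ∀ w → distinct S w ≡ distinct T w
distinct-↭ {S} {T} p w = Ind-≡ (Unique-map-↭ w p) (Unique-map-↭ w (↭-sym p))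
  (ind (unique? (map w S))) (ind (unique? (map w T)))

equal-↭ : ∀ {S T} → S ↭ T → ∀ w → equal S w ≡ equal T w
equal-↭ {S} {T} p w = Ind-≡
  (λ a i j i∈ j∈ → a i j (↭.∈-resp-↭ (↭-sym p) i∈) (↭.∈-resp-↭ (↭-sym p) j∈))
  (λ a i j i∈ j∈ → a i j (↭.∈-resp-↭ p i∈) (↭.∈-resp-↭ p j∈))
  (ind (allEqual? w S)) (ind (allEqual? w T))

distinct-singleton : ∀ x w → distinct [ x ] w ≡ 1ℚ
distinct-singleton x w = indicator-yes (unique? (w x ∷ [])) ([] ∷ [])

equal-singleton : ∀ x w → equal [ x ] w ≡ 1ℚ
equal-singleton x w = indicator-yes (allEqual? w [ x ]) λ { _ _ (here refl) (here refl) → refl }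

Σδ-fresh : ∀ w x S → All (w x ≢_) (map w S) → Σ[ S ] (λ s → δ x s w) ≡ 0ℚ
Σδ-fresh w x []      []       = refl
Σδ-fresh w x (s ∷ S) (p ∷ ps) = cong₂ _+_ (indicator-no (w x ℕ.≟ w s) p) (Σδ-fresh w x S ps)

Σδ-repeated : ∀ w x S → Unique (map w S) → ¬ All (w x ≢_) (map w S) → Σ[ S ] (λ s → δ x s w) ≡ 1ℚ
Σδ-repeated w x []      u        ¬p = contradiction [] ¬p
Σδ-repeated w x (s ∷ S) (p ∷ u) ¬p = split (w x ℕ.≟ w s)
  where
  split : Dec (w x ≡ w s) → δ x s w + Σ[ S ] (λ s → δ x s w) ≡ 1ℚ
  split (yes eq) = cong₂ _+_ (indicator-yes (w x ℕ.≟ w s) eq) (Σδ-fresh w x S (subst (λ a → All (a ≢_) (map w S)) (sym eq) p))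
  split (no neq) = cong₂ _+_ (indicator-no (w x ℕ.≟ w s) neq) (Σδ-repeated w x S u (¬p ∘ (neq ∷_)))

-- When the letters on `S` are distinct, at most one of them equals the letter at `x`, so the sum of
-- the `δ x s` is itself 0 or 1.
distinct-∷ : ∀ x S w → distinct (x ∷ S) w ≡ distinct S w * (1ℚ + - Σ[ S ] (λ s → δ x s w))
distinct-∷ x S w = split (unique? (map w S)) (All.all? (λ a → ¬? (w x ℕ.≟ a)) (map w S))
  where
  split : Dec (Unique (map w S)) → Dec (All (w x ≢_) (map w S)) →
    distinct (x ∷ S) w ≡ distinct S w * (1ℚ + - Σ[ S ] (λ s → δ x s w))
  split (no ¬u) _ = trans (indicator-no (unique? (map w (x ∷ S))) λ { (_ ∷ u) → ¬u u })
    (sym (trans (cong (_* (1ℚ + - Σ[ S ] (λ s → δ x s w))) (indicator-no (unique? (map w S)) ¬u)) (ℚ.*-zeroˡ (1ℚ + - Σ[ S ] (λ s → δ x s w)))))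
  split (yes u) (yes p) = trans (indicator-yes (unique? (map w (x ∷ S))) (p ∷ u))
    (sym (cong₂ (λ a b → a * (1ℚ + - b)) (indicator-yes (unique? (map w S)) u) (Σδ-fresh w x S p)))
  split (yes u) (no ¬p) = trans (indicator-no (unique? (map w (x ∷ S))) λ { (p ∷ _) → ¬p p })
    (sym (cong₂ (λ a b → a * (1ℚ + - b)) (indicator-yes (unique? (map w S)) u) (Σδ-repeated w x S u ¬p)))

-- Linear spans of products over set partitions

prod : (List ℕ → Fn) → List (List ℕ) → Fn
prod g []       w = 1ℚ
prod g (A ∷ BB) w = g A w * prod g BB w

prod-++ : ∀ g AA BB w → prod g (AA ++ BB) w ≡ prod g AA w * prod g BB w
prod-++ g []       BB w = sym (ℚ.*-identityˡ (prod g BB w))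
prod-++ g (A ∷ AA) BB w = trans (cong (g A w *_) (prod-++ g AA BB w)) (sym (ℚ.*-assoc (g A w) (prod g AA w) (prod g BB w)))

prod-↭ : ∀ g {AA BB} → AA ↭ BB → ∀ w → prod g AA w ≡ prod g BB w
prod-↭ g Perm.refl         w = refl
prod-↭ g (prep A p)        w = cong (g A w *_) (prod-↭ g p w)
prod-↭ g (swap {AA} {BB} A B p) w = trans (cong (λ z → g A w * (g B w * z)) (prod-↭ g p w))
  (solve 3 (λ a b c → a :* (b :* c) := b :* (a :* c)) refl (g A w) (g B w) (prod g BB w))
prod-↭ g (Perm.trans p q)  w = trans (prod-↭ g p w) (prod-↭ g q w)

concat-↭ : ∀ {A : Set} {xss yss : List (List A)} → xss ↭ yss → concat xss ↭ concat yss
concat-↭ Perm.refl                   = ↭-refl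
concat-↭ (prep xs p)                 = ↭.++⁺ˡ xs (concat-↭ p)
concat-↭ (swap {xss} {yss} xs ys p)  = ↭-trans (↭.shifts xs ys {concat xss}) (↭.++⁺ˡ ys (↭.++⁺ˡ xs (concat-↭ p)))
concat-↭ (Perm.trans p q)            = ↭-trans (concat-↭ p) (concat-↭ q)

-- For `S` without repetition, `concat BB ↭ S` says that the nonempty members of `BB` partition `S`.
-- Closure under pointwise equality is a constructor, in place of function extensionality.
data Span (g : List ℕ → Fn) (S : List ℕ) : Fn → Set where
  basis : ∀ BB → concat BB ↭ S → Span g S (prod g BB)
  add   : ∀ {F G} → Span g S F → Span g S G → Span g S (λ w → F w + G w)
  scale : ∀ a {F} → Span g S F → Span g S (λ w → a * F w)
  ext   : ∀ {F G} → (∀ w → F w ≡ G w) → Span g S F → Span g S G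

Span-↭ : ∀ {g S T F} → S ↭ T → Span g S F → Span g T F
Span-↭ p (basis BB q) = basis BB (↭-trans q p)
Span-↭ p (add f g)    = add (Span-↭ p f) (Span-↭ p g)
Span-↭ p (scale a f)  = scale a (Span-↭ p f)
Span-↭ p (ext eq f)   = ext eq (Span-↭ p f)

Span-block : ∀ {g} S → Span g S (g S)
Span-block {g} S = ext (λ w → ℚ.*-identityʳ (g S w)) (basis [ S ] (↭-reflexive (List.++-identityʳ S)))

Span-0 : ∀ {g} S → Span g S (λ _ → 0ℚ)
Span-0 {g} S = ext (λ w → ℚ.*-zeroˡ (g S w)) (scale 0ℚ (Span-block S))

Span-* : ∀ {g S T F G} → Span g S F → Span g T G → Span g (S ++ T) (λ w → F w * G w)
Span-* {g} (basis AA p) (basis BB q) = ext (prod-++ g AA BB)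
  (basis (AA ++ BB) (↭-trans (↭-reflexive (sym (List.concat-++ AA BB))) (↭.++⁺ p q)))
Span-* {F = F} f (add {G} {H} g h) = ext (λ w → sym (ℚ.*-distribˡ-+ (F w) (G w) (H w))) (add (Span-* f g) (Span-* f h))
Span-* {F = F} f (scale a {G} g) = ext (λ w → solve 3 (λ a b c → a :* (b :* c) := b :* (a :* c)) refl a (F w) (G w)) (scale a (Span-* f g))
Span-* {F = F} f (ext eq g) = ext (λ w → cong (F w *_) (eq w)) (Span-* f g)
Span-* {G = G} (add {E} {F} e f) g@(basis _ _) = ext (λ w → sym (ℚ.*-distribʳ-+ (G w) (E w) (F w))) (add (Span-* e g) (Span-* f g))
Span-* {G = G} (scale a {F} f) g@(basis _ _) = ext (λ w → sym (ℚ.*-assoc a (F w) (G w))) (scale a (Span-* f g))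
Span-* {G = G} (ext eq f) g@(basis _ _) = ext (λ w → cong (_* G w) (eq w)) (Span-* f g)

-- Inverses of natural numbers

nat : ℕ → ℚ
nat zero    = 0ℚ
nat (suc n) = 1ℚ + nat n

nat-nonNegative : ∀ n → NonNegative (nat n)
nat-nonNegative zero    = _
nat-nonNegative (suc n) = ℚ.nonNeg+nonNeg⇒nonNeg 1ℚ (nat n) {{nat-nonNegative n}}

nat-positive : ∀ n → Positive (nat (suc n))
nat-positive n = ℚ.pos+nonNeg⇒pos 1ℚ (nat n) {{nat-nonNegative n}}

inv-suc : ℕ → ℚ
inv-suc n = (1/ nat (suc n)) {{ℚ.pos⇒nonZero (nat (suc n)) {{nat-positive n}}}}

nat*inv : ∀ n → nat (suc n) * inv-suc n ≡ 1ℚ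
nat*inv n = ℚ.*-inverseʳ (nat (suc n)) {{ℚ.pos⇒nonZero (nat (suc n)) {{nat-positive n}}}}

inv-nonNegative : ∀ n → NonNegative (inv-suc n)
inv-nonNegative n = ℚ.pos⇒nonNeg (inv-suc n) {{ℚ.1/pos⇒pos (nat (suc n)) {{nat-positive n}}}}

-- μ n = (−1)ⁿ n! is the Möbius number of the lattice of partitions of an
-- (n + 1)-set, hence the coefficient of equal in distinct.

μ μ⁻¹ : ℕ → ℚ
μ zero      = 1ℚ
μ (suc n)   = - (nat (suc n) * μ n)
μ⁻¹ zero    = 1ℚ
μ⁻¹ (suc n) = - (inv-suc n * μ⁻¹ n)

μ⁻¹*μ : ∀ n → μ⁻¹ n * μ n ≡ 1ℚ
μ⁻¹*μ zero    = refl
μ⁻¹*μ (suc n) = trans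
  (solve 4 (λ i b a m → (:- (i :* b)) :* (:- (a :* m)) := (a :* i) :* (b :* m)) refl (inv-suc n) (μ⁻¹ n) (nat (suc n)) (μ n))
  (cong₂ _*_ (nat*inv n) (μ⁻¹*μ n))

-- Möbius inversion on a single block

module _ (x : ℕ) where

  -- This interpolates between `distinct (x ∷ S)`, for empty `U`, and `equal (x ∷ U)`, for empty
  -- `S`.
  equal*distinct : List ℕ → List ℕ → Fn
  equal*distinct U S w = equal (x ∷ U) w * distinct (x ∷ S) w

  -- Expanding the factor 1 − Σ δ x s of distinct (x ∷ S) moves the elements
  -- of S one by one to the side of U; the term equal (x ∷ U) * distinct S left
  -- over each time is in the span by the hypothesis on shorter lists.

  equal*distinct-span : ∀ k U S → length S ≡ k →
    (∀ V → length V ℕ.≤ length (U ++ S) → Span distinct V (equal V)) →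
    Span distinct (x ∷ U ++ S) (λ w → equal*distinct U S w + - (μ k * equal (x ∷ U ++ S) w))
  equal*distinct-span zero U [] _ _ = ext vanish (Span-0 (x ∷ U ++ []))
    where
    vanish : ∀ w → 0ℚ ≡ equal*distinct U [] w + - (1ℚ * equal (x ∷ U ++ []) w)
    vanish w = sym (trans
      (cong₂ (λ a T → equal (x ∷ U) w * a + - (1ℚ * equal (x ∷ T) w)) (distinct-singleton x w) (List.++-identityʳ U))
      (solve 1 (λ a → a :* con 1ℚ :+ :- (con 1ℚ :* a) := con 0ℚ) refl (equal (x ∷ U) w)))
  equal*distinct-span (suc k) U S len short = ext combine (add first (scale (- 1ℚ) (sum S id)))
    where
    p : Fn
    p = equal (x ∷ U ++ S)

    G : ℕ → Fn
    G s w = equal (x ∷ U) w * (δ x s w * distinct S w)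

    first : Span distinct (x ∷ U ++ S) (λ w → equal (x ∷ U) w * distinct S w)
    first = Span-* (short (x ∷ U) shorter) (Span-block S)
      where
      -- `S` is nonempty here, so replacing it by the single `x` does not lengthen the list.
      shorter : suc (length U) ℕ.≤ length (U ++ S)
      shorter = ℕ.≤-trans (ℕ.≤-reflexive (ℕ.+-comm 1 (length U))) (ℕ.≤-trans
        (ℕ.+-monoʳ-≤ (length U) (ℕ.≤-trans (s≤s z≤n) (ℕ.≤-reflexive (sym len))))
        (ℕ.≤-reflexive (sym (List.length-++ U))))

    summand : ∀ {s} → s ∈ S → Span distinct (x ∷ U ++ S) (λ w → G s w + - (μ k * p w))
    summand {s} s∈S with ∈-∃++ s∈S
    ... | ys , zs , refl = ext pointwise (Span-↭ (prep x perm)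
      (equal*distinct-span k (s ∷ U) (ys ++ zs) len′
        λ V le → short V (ℕ.≤-trans le (ℕ.≤-reflexive (↭.↭-length perm)))))
      where
      pick : S ↭ s ∷ ys ++ zs
      pick = ↭.shift s ys zs

      perm : s ∷ U ++ (ys ++ zs) ↭ U ++ S
      perm = ↭-trans (↭-sym (↭.shift s U (ys ++ zs))) (↭.++⁺ˡ U (↭-sym pick))

      len′ : length (ys ++ zs) ≡ k
      len′ = ℕ.suc-injective (trans (sym (↭.↭-length pick)) len)

      -- Once the letters at `x` and `s` agree, `s` joins the equal positions and `x` can stand in
      -- for `s` among the distinct ones.
      pointwise : ∀ w → equal*distinct (s ∷ U) (ys ++ zs) w + - (μ k * equal (x ∷ s ∷ U ++ (ys ++ zs)) w)
        ≡ G s w + - (μ k * p w)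
      pointwise w = cong₂ (λ a b → a + - (μ k * b))
        (Ind-≡ to from
          (Ind-* (ind (allEqual? w (x ∷ s ∷ U))) (ind (unique? (map w (x ∷ ys ++ zs)))))
          (Ind-* (ind (allEqual? w (x ∷ U))) (Ind-* (ind (w x ℕ.≟ w s)) (ind (unique? (map w S))))))
        (equal-↭ (prep x perm) w)
        where
        P = AllEqual w (x ∷ s ∷ U) × Unique (map w (x ∷ ys ++ zs))
        Q = AllEqual w (x ∷ U) × (w x ≡ w s) × Unique (map w S)

        to : P → Q
        to (a , u) = (λ i j i∈ j∈ → a i j (there′ i∈) (there′ j∈)) , xs , Unique-map-↭ w (↭-sym pick) (subst (λ b → Unique (b ∷ map w (ys ++ zs))) xs u)
          where
          xs = a x s (here refl) (there (here refl))
          there′ : ∀ {i} → i ∈ x ∷ U → i ∈ x ∷ s ∷ U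
          there′ (here refl) = here refl
          there′ (there i∈)  = there (there i∈)

        from : Q → P
        from (a , xs , u) = (λ i j i∈ j∈ → trans (toX i∈) (sym (toX j∈))) ,
          subst (λ b → Unique (b ∷ map w (ys ++ zs))) (sym xs) (Unique-map-↭ w pick u)
          where
          toX : ∀ {i} → i ∈ x ∷ s ∷ U → w i ≡ w x
          toX (here refl)         = refl
          toX (there (here refl)) = sym xs
          toX (there (there i∈))  = a _ x (there i∈) (here refl)

    sum : ∀ T → (∀ {s} → s ∈ T → s ∈ S) →
      Span distinct (x ∷ U ++ S) (λ w → Σ[ T ] (λ s → G s w) + - (nat (length T) * (μ k * p w)))
    sum [] _ = ext (λ w → solve 1 (λ a → con 0ℚ := con 0ℚ :+ :- (con 0ℚ :* a)) refl (μ k * p w)) (Span-0 (x ∷ U ++ S))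
    sum (t ∷ T) T⊆S = ext (λ w → solve 4 (λ g s n q → (g :+ :- q) :+ (s :+ :- (n :* q)) := (g :+ s) :+ :- ((con 1ℚ :+ n) :* q)) refl
        (G t w) (Σ[ T ] (λ s → G s w)) (nat (length T)) (μ k * p w))
      (add (summand (T⊆S (here refl))) (sum T (T⊆S ∘ there)))

    ΣG : ∀ w T → Σ[ T ] (λ s → G s w) ≡ equal (x ∷ U) w * (Σ[ T ] (λ s → δ x s w) * distinct S w)
    ΣG w []      = solve 2 (λ a d → con 0ℚ := a :* (con 0ℚ :* d)) refl (equal (x ∷ U) w) (distinct S w)
    ΣG w (t ∷ T) = trans (cong (G t w +_) (ΣG w T))
      (solve 4 (λ a t s d → a :* (t :* d) :+ a :* (s :* d) := a :* ((t :+ s) :* d)) refl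
        (equal (x ∷ U) w) (δ x t w) (Σ[ T ] (λ s → δ x s w)) (distinct S w))

    -- Each of the `suc k` summands contributes `μ k`, with a minus sign in front of the sum; this
    -- is the recursion defining `μ (suc k)`.
    combine : ∀ w → equal (x ∷ U) w * distinct S w
        + - 1ℚ * (Σ[ S ] (λ s → G s w) + - (nat (length S) * (μ k * p w)))
      ≡ equal*distinct U S w + - (μ (suc k) * p w)
    combine w = trans
      (cong₂ (λ g n → equal (x ∷ U) w * distinct S w + - 1ℚ * (g + - (nat n * (μ k * p w)))) (ΣG w S) len)
      (trans
        (solve 6 (λ a d s n m q → a :* d :+ con (- 1ℚ) :* (a :* (s :* d) :+ :- (n :* (m :* q)))
            := a :* (d :* (con 1ℚ :+ :- s)) :+ :- (:- (n :* m) :* q)) refl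
          (equal (x ∷ U) w) (distinct S w) (Σ[ S ] (λ s → δ x s w)) (nat (suc k)) (μ k) (p w))
        (cong (λ a → equal (x ∷ U) w * a + - (μ (suc k) * p w)) (sym (distinct-∷ x S w))))

-- With `U` empty, `equal*distinct-span` puts `distinct (x ∷ S)` minus `μ k` times `equal (x ∷ S)`
-- in the span. The first term is there already, and dividing by `μ k` isolates the second.
equal-span : ∀ n S → length S ℕ.≤ n → Span distinct S (equal S)
equal-span n []      _ = ext (λ w → sym (indicator-yes (allEqual? w []) λ _ _ ())) (basis [] ↭-refl)
equal-span (suc n) (x ∷ S) (s≤s le) = ext isolate
  (scale (μ⁻¹ k) (add (Span-block (x ∷ S)) (scale (- 1ℚ)
    (equal*distinct-span x k [] S refl λ V le′ → equal-span n V (ℕ.≤-trans le′ le)))))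
  where
  k = length S
  isolate : ∀ w → μ⁻¹ k * (distinct (x ∷ S) w + - 1ℚ * (equal*distinct x [] S w + - (μ k * equal (x ∷ S) w))) ≡ equal (x ∷ S) w
  isolate w = trans
    (cong (λ a → μ⁻¹ k * (distinct (x ∷ S) w + - 1ℚ * (a * distinct (x ∷ S) w + - (μ k * equal (x ∷ S) w)))) (equal-singleton x w))
    (trans
      (solve 4 (λ b d m q → b :* (d :+ con (- 1ℚ) :* (con 1ℚ :* d :+ :- (m :* q))) := (b :* m) :* q) refl
        (μ⁻¹ k) (distinct (x ∷ S) w) (μ k) (equal (x ∷ S) w))
      (trans (cong (_* equal (x ∷ S) w) (μ⁻¹*μ k)) (ℚ.*-identityˡ (equal (x ∷ S) w))))

Span-equal⇒distinct : ∀ {S F} → Span equal S F → Span distinct S F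
Span-equal⇒distinct (basis BB p) = Span-↭ p (go BB)
  where
  go : ∀ BB → Span distinct (concat BB) (prod equal BB)
  go []       = basis [] ↭-refl
  go (A ∷ BB) = Span-* (equal-span (length A) A ℕ.≤-refl) (go BB)
Span-equal⇒distinct (add f g)    = add (Span-equal⇒distinct f) (Span-equal⇒distinct g)
Span-equal⇒distinct (scale a f)  = scale a (Span-equal⇒distinct f)
Span-equal⇒distinct (ext eq f)   = ext eq (Span-equal⇒distinct f)

-- Spans under identification of two letters

∈-↭ : ∀ {A : Set} {x : A} {xs} → x ∈ xs → ∃[ ys ] xs ↭ x ∷ ys
∈-↭ {x = x} x∈xs with ∈-∃++ x∈xs
... | ys , zs , refl = ys ++ zs , ↭.shift x ys zs

Span-equal-1 : ∀ S → Span equal S (λ _ → 1ℚ)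
Span-equal-1 S = ext (prod≡1 S) (basis (map [_] S) (↭-reflexive (List.concat-map-[_] S)))
  where
  prod≡1 : ∀ S w → prod equal (map [_] S) w ≡ 1ℚ
  prod≡1 []      w = refl
  prod≡1 (x ∷ S) w = cong₂ _*_ (equal-singleton x w) (prod≡1 S w)

-- If `i` and `j` share a block, the factor is absorbed; otherwise it merges their two blocks into
-- `A ++ C`.
Span-equal-δ : ∀ {S F i j} → i ∈ S → j ∈ S → Span equal S F → Span equal S (λ w → δ i j w * F w)
Span-equal-δ {S} {i = i} {j} i∈S j∈S (basis BB p)
  with ∈-concat⁻′ BB (↭.∈-resp-↭ (↭-sym p) i∈S)
... | A , i∈A , A∈BB with ∈-↭ A∈BB
... | BB₁ , q with ∈-++⁻ A (↭.∈-resp-↭ (↭-trans (↭-sym p) (concat-↭ q)) j∈S)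
... | inj₁ j∈A = ext absorb (basis BB p)
  where
  absorb : ∀ w → prod equal BB w ≡ δ i j w * prod equal BB w
  absorb w = trans (prod-↭ equal q w) (trans
    (cong (_* prod equal BB₁ w) (Ind-≡ (λ a → a i j i∈A j∈A , a) proj₂ (ind (allEqual? w A)) (Ind-* (ind (w i ℕ.≟ w j)) (ind (allEqual? w A)))))
    (trans (ℚ.*-assoc (δ i j w) (equal A w) (prod equal BB₁ w)) (cong (δ i j w *_) (sym (prod-↭ equal q w)))))
... | inj₂ j∈BB₁ with ∈-concat⁻′ BB₁ j∈BB₁
... | C , j∈C , C∈BB₁ with ∈-↭ C∈BB₁
... | BB₂ , r = ext merge (basis ((A ++ C) ∷ BB₂) perm)
  where
  perm : (A ++ C) ++ concat BB₂ ↭ S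
  perm = ↭-trans (↭-reflexive (List.++-assoc A C (concat BB₂)))
    (↭-trans (↭-sym (concat-↭ (↭-trans q (prep A r)))) p)

  merge : ∀ w → equal (A ++ C) w * prod equal BB₂ w ≡ δ i j w * prod equal BB w
  merge w = trans
    (cong (_* prod equal BB₂ w) (Ind-≡ to from (ind (allEqual? w (A ++ C)))
      (Ind-* (ind (w i ℕ.≟ w j)) (Ind-* (ind (allEqual? w A)) (ind (allEqual? w C))))))
    (trans
      (solve 4 (λ d a c b → (d :* (a :* c)) :* b := d :* (a :* (c :* b))) refl (δ i j w) (equal A w) (equal C w) (prod equal BB₂ w))
      (cong (δ i j w *_) (sym (prod-↭ equal (↭-trans q (prep A r)) w))))
    where
    to : AllEqual w (A ++ C) → (w i ≡ w j) × AllEqual w A × AllEqual w C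
    to a = a i j (∈-++⁺ˡ i∈A) (∈-++⁺ʳ A j∈C) ,
      (λ k l k∈ l∈ → a k l (∈-++⁺ˡ k∈) (∈-++⁺ˡ l∈)) , (λ k l k∈ l∈ → a k l (∈-++⁺ʳ A k∈) (∈-++⁺ʳ A l∈))

    from : (w i ≡ w j) × AllEqual w A × AllEqual w C → AllEqual w (A ++ C)
    from (ij , a , c) k l k∈ l∈ = trans (toI k∈) (sym (toI l∈))
      where
      toI : ∀ {k} → k ∈ A ++ C → w k ≡ w i
      toI k∈ with ∈-++⁻ A k∈
      ... | inj₁ k∈A = a _ i k∈A i∈A
      ... | inj₂ k∈C = trans (c _ j k∈C j∈C) (sym ij)
Span-equal-δ {i = i} {j} i∈ j∈ (add {F} {G} f g) = ext (λ w → sym (ℚ.*-distribˡ-+ (δ i j w) (F w) (G w)))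
  (add (Span-equal-δ i∈ j∈ f) (Span-equal-δ i∈ j∈ g))
Span-equal-δ {i = i} {j} i∈ j∈ (scale a {F} f) =
  ext (λ w → solve 3 (λ a b c → a :* (b :* c) := b :* (a :* c)) refl a (δ i j w) (F w)) (scale a (Span-equal-δ i∈ j∈ f))
Span-equal-δ {i = i} {j} i∈ j∈ (ext eq f) = ext (λ w → cong (δ i j w *_) (eq w)) (Span-equal-δ i∈ j∈ f)

-- Functions of the kernel of a word

-- Generation from equality tests provides both facts needed later by one induction: membership in
-- the span of block indicators, and dependence on the first `d` letters only.
data Kernel (d : ℕ) : Fn → Set where
  one   : Kernel d (λ _ → 1ℚ)
  tie   : ∀ {i j F} → i ℕ.< d → j ℕ.< d → Kernel d F → Kernel d (λ w → δ i j w * F w)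
  add   : ∀ {F G} → Kernel d F → Kernel d G → Kernel d (λ w → F w + G w)
  scale : ∀ a {F} → Kernel d F → Kernel d (λ w → a * F w)
  ext   : ∀ {F G} → (∀ w → F w ≡ G w) → Kernel d F → Kernel d G

Kernel-span : ∀ {d F} → Kernel d F → Span equal (downFrom d) F
Kernel-span {d} one       = Span-equal-1 (downFrom d)
Kernel-span (tie i< j< f) = Span-equal-δ (∈-downFrom⁺ i<) (∈-downFrom⁺ j<) (Kernel-span f)
Kernel-span (add f g)     = add (Kernel-span f) (Kernel-span g)
Kernel-span (scale a f)   = scale a (Kernel-span f)
Kernel-span (ext eq f)    = ext eq (Kernel-span f)

Kernel-local : ∀ {d F} → Kernel d F → ∀ {v w} → (∀ i → i ℕ.< d → v i ≡ w i) → F v ≡ F w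
Kernel-local one _ = refl
Kernel-local (tie {i} {j} i< j< f) {v} {w} eq = cong₂ _*_
  (cong₂ (λ a b → indicator (a ℕ.≟ b)) (eq i i<) (eq j j<)) (Kernel-local f eq)
Kernel-local (add f g)    eq = cong₂ _+_ (Kernel-local f eq) (Kernel-local g eq)
Kernel-local (scale a f)  eq = cong (a *_) (Kernel-local f eq)
Kernel-local (ext F≗G f) {v} {w} eq = trans (sym (F≗G v)) (trans (Kernel-local f eq) (F≗G w))

Kernel-suc : ∀ {d F} → Kernel d F → Kernel (suc d) F
Kernel-suc one           = one
Kernel-suc (tie i< j< f) = tie (ℕ.m<n⇒m<1+n i<) (ℕ.m<n⇒m<1+n j<) (Kernel-suc f)
Kernel-suc (add f g)     = add (Kernel-suc f) (Kernel-suc g)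
Kernel-suc (scale a f)   = scale a (Kernel-suc f)
Kernel-suc (ext eq f)    = ext eq (Kernel-suc f)

Kernel-sub : ∀ {d F G} → Kernel d F → Kernel d G → Kernel d (λ w → F w + - G w)
Kernel-sub {F = F} {G} f g = ext (λ w → solve 2 (λ a b → a :+ con (- 1ℚ) :* b := a :+ :- b) refl (F w) (G w)) (add f (scale (- 1ℚ) g))

Kernel-untie : ∀ {d i j F} → i ℕ.< d → j ℕ.< d → Kernel d F → Kernel d (λ w → (1ℚ + - δ i j w) * F w)
Kernel-untie {i = i} {j} {F} i< j< f =
  ext (λ w → solve 2 (λ a b → a :+ :- (b :* a) := (con 1ℚ :+ :- b) :* a) refl (F w) (δ i j w)) (Kernel-sub f (tie i< j< f))

Kernel-distinct : ∀ {d S F} → All (ℕ._< d) S → Kernel d F → Kernel d (λ w → distinct S w * F w)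
Kernel-distinct {F = F} [] f = ext (λ w → sym (ℚ.*-identityˡ (F w))) f
Kernel-distinct {d} {x ∷ S} {F} (x< ∷ S<) f = ext expand (Kernel-sub DF (Σ-tie S S<))
  where
  DF : Kernel d (λ w → distinct S w * F w)
  DF = Kernel-distinct S< f

  Σ-tie : ∀ T → All (ℕ._< d) T → Kernel d (λ w → Σ[ T ] (λ s → δ x s w) * (distinct S w * F w))
  Σ-tie [] [] = ext (λ w → solve 1 (λ a → con 0ℚ :* a := con 0ℚ :* a) refl (distinct S w * F w)) (scale 0ℚ DF)
  Σ-tie (t ∷ T) (t< ∷ T<) = ext (λ w → sym (ℚ.*-distribʳ-+ (distinct S w * F w) (δ x t w) (Σ[ T ] (λ s → δ x s w))))
    (add (tie x< t< DF) (Σ-tie T T<))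

  expand : ∀ w → distinct S w * F w + - (Σ[ S ] (λ s → δ x s w) * (distinct S w * F w)) ≡ distinct (x ∷ S) w * F w
  expand w = trans
    (solve 3 (λ d s f → d :* f :+ :- (s :* (d :* f)) := (d :* (con 1ℚ :+ :- s)) :* f) refl (distinct S w) (Σ[ S ] (λ s → δ x s w)) (F w))
    (cong (_* F w) (sym (distinct-∷ x S w)))

Kernel-prod : ∀ {d} BB → concat BB ↭ downFrom d → Kernel d (prod distinct BB)
Kernel-prod {d} BB p = go BB (↭.All-resp-↭ (↭-sym p) (All.tabulate ∈-downFrom⁻))
  where
  go : ∀ BB → All (ℕ._< d) (concat BB) → Kernel d (prod distinct BB)
  go []       _ = one
  go (A ∷ BB) p = Kernel-distinct (All.++⁻ˡ A p) (go BB (All.++⁻ʳ A p))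

-- Linear congruence modulo relabelings of the positions 0, …, n fixing n

infix 4 _⊢_≈_

data _⊢_≈_ (n : ℕ) : Fn → Fn → Set where
  ext     : ∀ {F G} → (∀ w → F w ≡ G w) → n ⊢ F ≈ G
  ≈-sym   : ∀ {F G} → n ⊢ F ≈ G → n ⊢ G ≈ F
  ≈-trans : ∀ {F G H} → n ⊢ F ≈ G → n ⊢ G ≈ H → n ⊢ F ≈ H
  add     : ∀ {F F′ G G′} → n ⊢ F ≈ F′ → n ⊢ G ≈ G′ → n ⊢ (λ w → F w + G w) ≈ (λ w → F′ w + G′ w)
  scale   : ∀ a {F G} → n ⊢ F ≈ G → n ⊢ (λ w → a * F w) ≈ (λ w → a * G w)
  -- All positions from `n` on are fixed, so the same `τ` is admissible at `suc n`. The `Kernel`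
  -- hypothesis provides the expansion whose class sums are compared.
  relabeled : ∀ {F} (τ : ℕ → ℕ) → Involutive τ → (∀ i → n ℕ.≤ i → τ i ≡ i) →
            Kernel (suc n) F → n ⊢ (λ w → F (w ∘ τ)) ≈ F

-- Read on one more position, `F` becomes F·e₁: the added letter is unconstrained.
≈-suc : ∀ {n F G} → n ⊢ F ≈ G → suc n ⊢ F ≈ G
≈-suc (ext eq)            = ext eq
≈-suc (≈-sym p)           = ≈-sym (≈-suc p)
≈-suc (≈-trans p q)       = ≈-trans (≈-suc p) (≈-suc q)
≈-suc (add p q)           = add (≈-suc p) (≈-suc q)
≈-suc (scale a p)         = scale a (≈-suc p)
≈-suc (relabeled τ inv fix f) = relabeled τ inv (λ i le → fix i (ℕ.≤-trans (ℕ.n≤1+n _) le)) (Kernel-suc f)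

-- Multiplying by copy n duplicates the last letter.

copy : ℕ → Fn
copy n = δ (suc n) n

-- An admissible relabeling moves neither `n` nor `suc n`, so the factor `copy n` is invariant under
-- it.
copy-cong : ∀ {n F G} → n ⊢ F ≈ G → suc n ⊢ (λ w → copy n w * F w) ≈ (λ w → copy n w * G w)
copy-cong {n} (ext eq)      = ext λ w → cong (copy n w *_) (eq w)
copy-cong (≈-sym p)         = ≈-sym (copy-cong p)
copy-cong (≈-trans p q)     = ≈-trans (copy-cong p) (copy-cong q)
copy-cong {n} (add {F} {F′} {G} {G′} p q) =
  ≈-trans (ext λ w → ℚ.*-distribˡ-+ (copy n w) (F w) (G w))
    (≈-trans (add (copy-cong p) (copy-cong q)) (ext λ w → sym (ℚ.*-distribˡ-+ (copy n w) (F′ w) (G′ w))))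
copy-cong {n} (scale a {F} {G} p) =
  ≈-trans (ext λ w → swap* (copy n w) (F w)) (≈-trans (scale a (copy-cong p)) (ext λ w → sym (swap* (copy n w) (G w))))
  where
  swap* : ∀ b c → b * (a * c) ≡ a * (b * c)
  swap* b c = solve 3 (λ a b c → b :* (a :* c) := a :* (b :* c)) refl a b c
copy-cong {n} (relabeled {F} τ inv fix f) = ≈-trans
  (ext λ w → cong (_* F (w ∘ τ)) (cong₂ (λ a b → indicator (w a ℕ.≟ w b)) (sym (fix (suc n) (ℕ.n≤1+n n))) (sym (fix n ℕ.≤-refl))))
  (relabeled τ inv (λ i le → fix i (ℕ.≤-trans (ℕ.n≤1+n n) le)) (tie ℕ.≤-refl (ℕ.n≤1+n (suc n)) (Kernel-suc f)))

≈-sub : ∀ {n F F′ G G′} → n ⊢ F ≈ F′ → n ⊢ G ≈ G′ → n ⊢ (λ w → F w + - G w) ≈ (λ w → F′ w + - G′ w)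
≈-sub {F = F} {F′} {G} {G′} p q = ≈-trans (ext λ w → neg (F w) (G w))
  (≈-trans (add p (scale (- 1ℚ) q)) (ext λ w → sym (neg (F′ w) (G′ w))))
  where
  neg : ∀ a b → a + - b ≡ a + - 1ℚ * b
  neg a b = solve 2 (λ a b → a :+ :- b := a :+ con (- 1ℚ) :* b) refl a b

≈-minus : ∀ {n G G′} F → n ⊢ G ≈ G′ → n ⊢ (λ w → F w + - G w) ≈ (λ w → F w + - G′ w)
≈-minus F p = ≈-sub (ext {F = F} λ _ → refl) p

-- Transpositions

transpose : ℕ → ℕ → ℕ → ℕ
transpose i j k with k ℕ.≟ i | k ℕ.≟ j
... | yes _ | _     = j
... | no _  | yes _ = i
... | no _  | no _  = k

transpose-matchˡ : ∀ i j → transpose i j i ≡ j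
transpose-matchˡ i j with i ℕ.≟ i | i ℕ.≟ j
... | yes _  | _ = refl
... | no i≢i | _ = contradiction refl i≢i

transpose-matchʳ : ∀ i j → transpose i j j ≡ i
transpose-matchʳ i j with j ℕ.≟ i | j ℕ.≟ j
... | yes j≡i | _      = j≡i
... | no _    | yes _  = refl
... | no _    | no j≢j = contradiction refl j≢j

transpose-mismatch : ∀ i j {k} → k ≢ i → k ≢ j → transpose i j k ≡ k
transpose-mismatch i j {k} k≢i k≢j with k ℕ.≟ i | k ℕ.≟ j
... | yes k≡i | _       = contradiction k≡i k≢i
... | no _    | yes k≡j = contradiction k≡j k≢j
... | no _    | no _    = refl

transpose-involutive : ∀ i j → Involutive (transpose i j)
transpose-involutive i j k = split (k ℕ.≟ i) (k ℕ.≟ j)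
  where
  split : Dec (k ≡ i) → Dec (k ≡ j) → transpose i j (transpose i j k) ≡ k
  split (yes refl) _ = trans (cong (transpose i j) (transpose-matchˡ i j)) (transpose-matchʳ i j)
  split (no _) (yes refl) = trans (cong (transpose i j) (transpose-matchʳ i j)) (transpose-matchˡ i j)
  split (no k≢i) (no k≢j) = trans (cong (transpose i j) (transpose-mismatch i j k≢i k≢j)) (transpose-mismatch i j k≢i k≢j)

-- Runs of consecutive positions

-- The order is decreasing so that a run continues `downFrom k` and its head is the last position.
run : ℕ → ℕ → List ℕ
run k zero    = []
run k (suc b) = b ℕ.+ k ∷ run k b

run-++-downFrom : ∀ k b → run k b ++ downFrom k ≡ downFrom (b ℕ.+ k)
run-++-downFrom k zero    = refl
run-++-downFrom k (suc b) = cong (b ℕ.+ k ∷_) (run-++-downFrom k b)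

length-run : ∀ k b → length (run k b) ≡ b
length-run k zero    = refl
length-run k (suc b) = cong suc (length-run k b)

∈-run⁻ : ∀ k b {i} → i ∈ run k b → k ℕ.≤ i × i ℕ.< b ℕ.+ k
∈-run⁻ k (suc b) (here refl) = ℕ.m≤n+m k b , ℕ.≤-refl
∈-run⁻ k (suc b) (there i∈)  with ∈-run⁻ k b i∈
... | k≤i , i< = k≤i , ℕ.m<n⇒m<1+n i<

run-unique : ∀ k b → Unique (run k b)
run-unique k zero    = []
run-unique k (suc b) = All.tabulate (λ i∈ eq → ℕ.<-irrefl (sym eq) (proj₂ (∈-run⁻ k b i∈))) ∷ run-unique k b

run-↭ : ∀ BB k b → concat BB ↭ downFrom k → concat (run k b ∷ BB) ↭ downFrom (b ℕ.+ k)
run-↭ BB k b p = ↭-trans (↭.++⁺ˡ (run k b) p) (↭-reflexive (run-++-downFrom k b))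

-- All positions of the last block play the same role up to relabeling,
-- so identifying a new letter with the last one amounts to the average over
-- identifying it with any letter of that block.

copy-prod : ∀ a k BB → concat BB ↭ downFrom k → suc (a ℕ.+ k) ⊢
  (λ w → copy (a ℕ.+ k) w * prod distinct (run k (suc a) ∷ BB) w) ≈
  (λ w → inv-suc a * (prod distinct (run k (suc a) ∷ BB) w + - prod distinct (run k (suc (suc a)) ∷ BB) w))
copy-prod a k BB p = ≈-trans (ext λ w → unscale (copy n w * X w))
  (scale (inv-suc a) (≈-trans (≈-sym (Σ-copy R id)) (ext telescope)))
  where
  n = a ℕ.+ k
  R = run k (suc a)

  X : Fn
  X = prod distinct (R ∷ BB)

  -- The transposition of `j` and `n` permutes the last block, fixes all positions below `k` as well
  -- as `suc n`, and so changes only the copied letter.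
  swap-copy : ∀ {j} → j ∈ R → suc n ⊢ (λ w → δ (suc n) j w * X w) ≈ (λ w → copy n w * X w)
  swap-copy {j} j∈R = ≈-trans (ext pointwise)
    (relabeled τ (transpose-involutive j n)
      (λ i n<i → transpose-mismatch j n (λ { refl → ℕ.<-irrefl refl (ℕ.<-≤-trans (proj₂ j-bounds) n<i) }) (λ { refl → ℕ.<-irrefl refl n<i }))
      (tie ℕ.≤-refl (ℕ.n≤1+n (suc n)) (Kernel-suc (Kernel-prod (R ∷ BB) (run-↭ BB k (suc a) p)))))
    where
    τ = transpose j n
    j-bounds = ∈-run⁻ k (suc a) j∈R

    closed : ∀ {i} → i ∈ R → τ i ∈ R
    closed {i} i∈R = split (i ℕ.≟ j) (i ℕ.≟ n)
      where
      split : Dec (i ≡ j) → Dec (i ≡ n) → τ i ∈ R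
      split (yes refl) _ = subst (_∈ R) (sym (transpose-matchˡ j n)) (here refl)
      split (no _) (yes refl) = subst (_∈ R) (sym (transpose-matchʳ j n)) j∈R
      split (no i≢j) (no i≢n) = subst (_∈ R) (sym (transpose-mismatch j n i≢j i≢n)) i∈R

    pointwise : ∀ w → δ (suc n) j w * X w ≡ copy n (w ∘ τ) * X (w ∘ τ)
    pointwise w = cong₂ _*_
      (cong₂ (λ b c → indicator (w b ℕ.≟ w c))
        (sym (transpose-mismatch j n (λ { refl → ℕ.<-irrefl refl (proj₂ j-bounds) }) (ℕ.1+n≢n)))
        (sym (transpose-matchʳ j n)))
      (cong₂ _*_
        (trans (sym (distinct-↭ (map-involution-↭ (transpose-involutive j n) (run-unique k (suc a)) closed) w))
          (cong (λ l → indicator (unique? l)) (sym (List.map-∘ R))))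
        (Kernel-local (Kernel-prod BB p) λ i i<k → cong w (sym (transpose-mismatch j n
          (λ { refl → ℕ.<-irrefl refl (ℕ.<-≤-trans i<k (proj₁ j-bounds)) })
          (λ { refl → ℕ.<-irrefl refl (ℕ.<-≤-trans i<k (ℕ.m≤n+m k a)) })))))

  Σ-copy : ∀ T → (∀ {j} → j ∈ T → j ∈ R) →
    suc n ⊢ (λ w → Σ[ T ] (λ j → δ (suc n) j w) * X w) ≈ (λ w → nat (length T) * (copy n w * X w))
  Σ-copy [] _ = ext λ w → trans (ℚ.*-zeroˡ (X w)) (sym (ℚ.*-zeroˡ (copy n w * X w)))
  Σ-copy (t ∷ T) T⊆R = ≈-trans
    (ext λ w → ℚ.*-distribʳ-+ (X w) (δ (suc n) t w) (Σ[ T ] (λ j → δ (suc n) j w)))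
    (≈-trans (add (swap-copy (T⊆R (here refl))) (Σ-copy T (T⊆R ∘ there)))
      (ext λ w → solve 2 (λ m x → x :+ m :* x := (con 1ℚ :+ m) :* x) refl (nat (length T)) (copy n w * X w)))

  -- By `distinct-∷`, placing `suc n` in the last block multiplies by one minus this sum.
  telescope : ∀ w → Σ[ R ] (λ j → δ (suc n) j w) * X w ≡ X w + - prod distinct ((suc n ∷ R) ∷ BB) w
  telescope w = sym (trans
    (cong (λ z → X w + - (z * prod distinct BB w)) (distinct-∷ (suc n) R w))
    (solve 3 (λ s d x → d :* x :+ :- ((d :* (con 1ℚ :+ :- s)) :* x) := s :* (d :* x)) refl
      (Σ[ R ] (λ j → δ (suc n) j w)) (distinct R w) (prod distinct BB w)))

  unscale : ∀ x → x ≡ inv-suc a * (nat (length R) * x)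
  unscale x = sym (trans
    (cong (λ m → inv-suc a * (nat m * x)) (length-run k (suc a)))
    (trans (solve 3 (λ i m x → i :* (m :* x) := (m :* i) :* x) refl (inv-suc a) (nat (suc a)) x)
      (trans (cong (_* x) (nat*inv a)) (ℚ.*-identityˡ x))))

-- In a pair (P , C) the term c e_σ of P with last block of size a + 1
-- is matched by the term a c e_σ of C: this is how the expansions of
-- a path and of the cycle on the same vertices are related.

data Combo : ℕ → Fn → Fn → Set where
  -- The last block occupies a final run of positions. Both ways of adding a vertex keep this normal
  -- form: the run grows by one, or joins `BB` and a singleton run starts.
  term : ∀ c → 0ℚ ≤ c → ∀ a k BB → concat BB ↭ downFrom k →
         Combo (a ℕ.+ k) (λ w → c * prod distinct (run k (suc a) ∷ BB) w)
                         (λ w → nat a * (c * prod distinct (run k (suc a) ∷ BB) w))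
  _⊞_  : ∀ {n P P′ C C′} → Combo n P C → Combo n P′ C′ →
         Combo n (λ w → P w + P′ w) (λ w → C w + C′ w)

*-nonNeg : ∀ {p q} → 0ℚ ≤ p → 0ℚ ≤ q → 0ℚ ≤ p * q
*-nonNeg {p} {q} 0≤p 0≤q = ℚ.nonNegative⁻¹ (p * q)
  {{ℚ.nonNeg*nonNeg⇒nonNeg p {{nonNegative 0≤p}} q {{nonNegative 0≤q}}}}

0≤nat : ∀ n → 0ℚ ≤ nat n
0≤nat n = ℚ.nonNegative⁻¹ (nat n) {{nat-nonNegative n}}

0≤inv-suc : ∀ n → 0ℚ ≤ inv-suc n
0≤inv-suc n = ℚ.nonNegative⁻¹ (inv-suc n) {{inv-nonNegative n}}

-- Deletion-contraction on nonnegative combinations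

module _ (a k : ℕ) {BB : List (List ℕ)} (p : concat BB ↭ downFrom k) where

  private
    X X⁺ : Fn
    X  = prod distinct (run k (suc a) ∷ BB)
    X⁺ = prod distinct (run k (suc (suc a)) ∷ BB)

    n = a ℕ.+ k

  enlarge : ∀ {c} → 0ℚ ≤ c → ∃[ C ] Combo (suc n) (λ w → c * X⁺ w) C × (∀ w → C w ≡ nat (suc a) * (c * X⁺ w))
  enlarge {c} 0≤c = _ , term c 0≤c (suc a) k BB p , λ _ → refl

  -- The new last block is a singleton, so its weight in the cycle component is `nat 0`, which makes
  -- that component vanish.
  close : ∀ {c} → 0ℚ ≤ c → ∃[ P ] ∃[ C ] Combo (suc n) P C × (∀ w → P w ≡ c * X w) × (∀ w → C w ≡ 0ℚ)
  close {c} 0≤c = _ , _ , term c 0≤c 0 (suc n) (run k (suc a) ∷ BB) (run-↭ BB k (suc a) p) ,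
    (λ w → cong (c *_) (trans (cong (_* X w) (distinct-singleton (suc n) w)) (ℚ.*-identityˡ (X w)))) ,
    (λ w → ℚ.*-zeroˡ (c * (distinct [ suc n ] w * X w)))

two : ℚ
two = 1ℚ + 1ℚ

0≤two : 0ℚ ≤ two
0≤two = ℚ.nonNegative⁻¹ two

module _ {i z} (inverse : (1ℚ + z) * i ≡ 1ℚ) (c x y : ℚ) where

  private
    -- Inserting `(1ℚ + z) * i` into the leading term is the one use of `inverse`; the remaining
    -- identity is polynomial. Below, `1ℚ + z` is the block size b, `x` is E_b·e₁ and `y` is
    -- E_{b+1}.
    rescale : ∀ u {v t} → ((1ℚ + z) * i) * u + v ≡ t → u + v ≡ t
    rescale u {v} = trans (cong (_+ v) (trans (sym (ℚ.*-identityˡ u)) (cong (_* u) (sym inverse))))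

  extend-path-ring : c * x + - (c * (i * (x + - y))) ≡ c * i * y + c * i * z * x
  extend-path-ring = rescale (c * x) (solve 5 (λ c i z x y →
    ((con 1ℚ :+ z) :* i) :* (c :* x) :+ :- (c :* (i :* (x :+ :- y))) := c :* i :* y :+ c :* i :* z :* x) refl c i z x y)

  -- One contraction from the path and `z` from the cycle make b in all, and together they cancel
  -- `x`. This is the 0 that a singleton last block requires, and the remaining c·y is b times the
  -- path coefficient c/b, as an enlarged block requires.
  extend-cycle-ring : c * x + - ((1ℚ + z) * c * (i * (x + - y))) ≡ (1ℚ + z) * (c * i * y) + 0ℚ
  extend-cycle-ring = rescale (c * x) (solve 5 (λ c i z x y →
    ((con 1ℚ :+ z) :* i) :* (c :* x) :+ :- ((con 1ℚ :+ z) :* c :* (i :* (x :+ :- y))) := (con 1ℚ :+ z) :* (c :* i :* y) :+ con 0ℚ) refl c i z x y)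

  -- The coefficient of `x` is z c (1 - 2/b), and 1 - 2/b = (z - 1)/b because b = 1 + z.
  attach-ring : z * (c * x) + - (two * z * c * (i * (x + - y))) ≡ two * z * (c * i) * y + z * (z + - 1ℚ) * (c * i) * x
  attach-ring = rescale (z * (c * x)) (solve 5 (λ c i z x y →
    ((con 1ℚ :+ z) :* i) :* (z :* (c :* x)) :+ :- (con two :* z :* c :* (i :* (x :+ :- y)))
      := con two :* z :* (c :* i) :* y :+ z :* (z :+ :- con 1ℚ) :* (c :* i) :* x) refl c i z x y)

move-copy : ∀ c x d → c * x + - (d * (c * x)) ≡ c * x + - (c * (d * x))
move-copy = solve 3 (λ c x d → c :* x :+ :- (d :* (c :* x)) := c :* x :+ :- (c :* (d :* x))) refl

move-copies : ∀ c x d z → (c * x + - (d * (c * x))) + - (d * (z * (c * x))) ≡ c * x + - ((1ℚ + z) * c * (d * x))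
move-copies = solve 4 (λ c x d z →
  (c :* x :+ :- (d :* (c :* x))) :+ :- (d :* (z :* (c :* x))) := c :* x :+ :- ((con 1ℚ :+ z) :* c :* (d :* x))) refl

move-two-copies : ∀ c x d z → z * (c * x) + - (two * (d * (z * (c * x)))) ≡ z * (c * x) + - (two * z * c * (d * x))
move-two-copies = solve 4 (λ c x d z →
  z :* (c :* x) :+ :- (con two :* (d :* (z :* (c :* x)))) := z :* (c :* x) :+ :- (con two :* z :* c :* (d :* x))) refl

-- The two congruences are the path and cycle recurrences. A single new pair satisfies both, which
-- keeps the weights `nat a` in force for the next vertex.
step : ∀ {n P C} → Combo n P C → ∃[ P′ ] ∃[ C′ ] Combo (suc n) P′ C′ ×
  (suc n ⊢ (λ w → P w + - (copy n w * P w)) ≈ P′) ×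
  (suc n ⊢ (λ w → (P w + - (copy n w * P w)) + - (copy n w * C w)) ≈ C′)
step (term c 0≤c a k BB p) =
  let C₁ , t₁ , eC₁ = enlarge a k {BB} p {c * inv-suc a} (*-nonNeg 0≤c (0≤inv-suc a))
      P₂ , C₂ , t₂ , eP₂ , eC₂ = close a k {BB} p {c * inv-suc a * nat a} (*-nonNeg (*-nonNeg 0≤c (0≤inv-suc a)) (0≤nat a))
  in
  _ , _ , (t₁ ⊞ t₂) ,
  ≈-trans (≈-trans
    (ext λ w → move-copy c (X w) (copy (a ℕ.+ k) w))
    (≈-minus (λ w → c * X w) (scale c (copy-prod a k BB p))))
    (ext λ w → trans (extend-path-ring {inv-suc a} {nat a} (nat*inv a) c (X w) (X⁺ w)) (cong (c * inv-suc a * X⁺ w +_) (sym (eP₂ w)))) ,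
  ≈-trans (≈-trans
    (ext λ w → move-copies c (X w) (copy (a ℕ.+ k) w) (nat a))
    (≈-minus (λ w → c * X w) (scale (nat (suc a) * c) (copy-prod a k BB p))))
    (ext λ w → trans (extend-cycle-ring {inv-suc a} {nat a} (nat*inv a) c (X w) (X⁺ w)) (cong₂ _+_ (sym (eC₁ w)) (sym (eC₂ w))))
  where
  X X⁺ : Fn
  X  = prod distinct (run k (suc a) ∷ BB)
  X⁺ = prod distinct (run k (suc (suc a)) ∷ BB)
step {n} (_⊞_ {P = P} {P′} {C} {C′} s s′) with step s | step s′
... | Q , D , t , p , q | Q′ , D′ , t′ , p′ , q′ = _ , _ , (t ⊞ t′) ,
  ≈-trans (ext λ w → solve 3 (λ p p′ d → (p :+ p′) :+ :- (d :* (p :+ p′)) := (p :+ :- (d :* p)) :+ (p′ :+ :- (d :* p′))) refl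
    (P w) (P′ w) (copy n w)) (add p p′) ,
  ≈-trans (ext λ w → solve 5 (λ p p′ c c′ d → ((p :+ p′) :+ :- (d :* (p :+ p′))) :+ :- (d :* (c :+ c′))
      := ((p :+ :- (d :* p)) :+ :- (d :* c)) :+ ((p′ :+ :- (d :* p′)) :+ :- (d :* c′))) refl
    (P w) (P′ w) (C w) (C′ w) (copy n w)) (add q q′)

attach : ∀ {n P C} → Combo n P C → ∃[ P′ ] ∃[ C′ ] Combo (suc n) P′ C′ ×
  (suc n ⊢ (λ w → C w + - (two * (copy n w * C w))) ≈ P′)
attach (term c 0≤c a k BB p) =
  let C₁ , t₁ , eC₁ = enlarge a k {BB} p {two * nat a * (c * inv-suc a)}
        (*-nonNeg (*-nonNeg 0≤two (0≤nat a)) (*-nonNeg 0≤c (0≤inv-suc a)))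
      P₂ , C₂ , t₂ , eP₂ , eC₂ = close a k {BB} p {nat a * nat (ℕ.pred a) * (c * inv-suc a)}
        (*-nonNeg (*-nonNeg (0≤nat a) (0≤nat (ℕ.pred a))) (*-nonNeg 0≤c (0≤inv-suc a)))
  in
  _ , _ , (t₁ ⊞ t₂) ,
  ≈-trans (≈-trans
    (ext λ w → move-two-copies c (X w) (copy (a ℕ.+ k) w) (nat a))
    (≈-minus (λ w → nat a * (c * X w)) (scale (two * nat a * c) (copy-prod a k BB p))))
    (ext λ w → trans (attach-ring {inv-suc a} {nat a} (nat*inv a) c (X w) (X⁺ w))
      (cong (two * nat a * (c * inv-suc a) * X⁺ w +_) (trans (cong (λ z → z * (c * inv-suc a) * X w) (predecessor a)) (sym (eP₂ w)))))
  where
  X X⁺ : Fn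
  X  = prod distinct (run k (suc a) ∷ BB)
  X⁺ = prod distinct (run k (suc (suc a)) ∷ BB)

  -- For a singleton last block the negative factor `nat 0 + - 1ℚ` is multiplied by 0, so
  -- `pred 0 = 0` may replace it and the coefficient is visibly nonnegative.
  predecessor : ∀ b → nat b * (nat b + - 1ℚ) ≡ nat b * nat (ℕ.pred b)
  predecessor zero    = refl
  predecessor (suc b) = cong (nat (suc b) *_) (solve 1 (λ z → (con 1ℚ :+ z) :+ :- con 1ℚ := z) refl (nat b))
attach {n} (_⊞_ {C = C} {C′} s s′) with attach s | attach s′
... | Q , D , t , p | Q′ , D′ , t′ , p′ = _ , _ , (t ⊞ t′) ,
  ≈-trans (ext λ w → solve 3 (λ c c′ d → (c :+ c′) :+ :- (con two :* (d :* (c :+ c′)))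
      := (c :+ :- (con two :* (d :* c))) :+ (c′ :+ :- (con two :* (d :* c′)))) refl (C w) (C′ w) (copy n w)) (add p p′)

-- Paths, cycles and tadpoles on the vertices 0, 1, …

-- The index is the last position, so this path has n + 1 vertices.
pathFn : ℕ → Fn
pathFn zero    w = 1ℚ
pathFn (suc n) w = (1ℚ + - copy n w) * pathFn n w

-- At n = 0 the closing edge is a loop and the function is 0; this is the value that starts the
-- induction.
cycleFn : ℕ → Fn
cycleFn n w = (1ℚ + - δ n 0 w) * pathFn n w

-- This is L(Tp_{n+1,l+1}): the cycle occupies 0, ..., n and the path n + 1, ..., n + 1 + l.
tadpoleFn : ℕ → ℕ → Fn
tadpoleFn n zero    w = (1ℚ + - copy n w) * ((1ℚ + - δ (suc n) 0 w) * cycleFn n w)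
tadpoleFn n (suc l) w = (1ℚ + - copy (suc (l ℕ.+ n)) w) * tadpoleFn n l w

ProperPath : ℕ → (ℕ → ℕ) → Set
ProperPath n w = ∀ i → i ℕ.< n → w (suc i) ≢ w i

ProperCycle : ℕ → (ℕ → ℕ) → Set
ProperCycle n w = w n ≢ w 0 × ProperPath n w

Ind-untie : ∀ i j w → Ind (w i ≢ w j) (1ℚ + - δ i j w)
Ind-untie i j w = Ind-¬ (ind (w i ℕ.≟ w j))

Ind-⇔ : ∀ {P Q a} → (P → Q) → (Q → P) → Ind P a → Ind Q a
Ind-⇔ to from (holds p) = holds (to p)
Ind-⇔ to from (fails p) = fails (p ∘ from)

pathFn-ind : ∀ n w → Ind (ProperPath n w) (pathFn n w)
pathFn-ind zero    w = holds λ _ ()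
pathFn-ind (suc n) w = Ind-⇔ to from (Ind-* (Ind-untie (suc n) n w) (pathFn-ind n w))
  where
  to : (w (suc n) ≢ w n) × ProperPath n w → ProperPath (suc n) w
  to (last , p) i (s≤s i≤n) with ℕ.m≤n⇒m<n∨m≡n i≤n
  ... | inj₁ i<n  = p i i<n
  ... | inj₂ refl = last

  from : ProperPath (suc n) w → (w (suc n) ≢ w n) × ProperPath n w
  from p = p n ℕ.≤-refl , λ i i<n → p i (ℕ.m<n⇒m<1+n i<n)

cycleFn-ind : ∀ n w → Ind (ProperCycle n w) (cycleFn n w)
cycleFn-ind n w = Ind-* (Ind-untie n 0 w) (pathFn-ind n w)

pathFn-kernel : ∀ n → Kernel (suc n) (pathFn n)
pathFn-kernel zero    = one
pathFn-kernel (suc n) = Kernel-untie ℕ.≤-refl (ℕ.n≤1+n (suc n)) (Kernel-suc (pathFn-kernel n))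

cycleFn-kernel : ∀ n → Kernel (suc n) (cycleFn n)
cycleFn-kernel n = Kernel-untie ℕ.≤-refl (s≤s z≤n) (pathFn-kernel n)

reflect : ℕ → ℕ → ℕ
reflect n i with i ℕ.≤? n
... | yes _ = n ℕ.∸ i
... | no _  = i

reflect-≤ : ∀ {n i} → i ℕ.≤ n → reflect n i ≡ n ℕ.∸ i
reflect-≤ {n} {i} i≤n with i ℕ.≤? n
... | yes _  = refl
... | no i≰n = contradiction i≤n i≰n

reflect-> : ∀ {n i} → n ℕ.< i → reflect n i ≡ i
reflect-> {n} {i} n<i with i ℕ.≤? n
... | yes i≤n = contradiction i≤n (ℕ.<⇒≱ n<i)
... | no _    = refl

reflect-involutive : ∀ n → Involutive (reflect n)
reflect-involutive n i = split (i ℕ.≤? n)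
  where
  split : Dec (i ℕ.≤ n) → reflect n (reflect n i) ≡ i
  split (yes i≤n) = trans (cong (reflect n) (reflect-≤ i≤n)) (trans (reflect-≤ (ℕ.m∸n≤m n i)) (ℕ.m∸[m∸n]≡n i≤n))
  split (no i≰n)  = trans (cong (reflect n) (reflect-> (ℕ.≰⇒> i≰n))) (reflect-> (ℕ.≰⇒> i≰n))

cycleFn-reflect : ∀ n w → cycleFn n (w ∘ reflect n) ≡ cycleFn n w
cycleFn-reflect n w = Ind-≡ to from (cycleFn-ind n (w ∘ reflect n)) (cycleFn-ind n w)
  where
  at-n : reflect n n ≡ 0
  at-n = trans (reflect-≤ {n} ℕ.≤-refl) (ℕ.n∸n≡0 n)

  at-0 : reflect n 0 ≡ n
  at-0 = reflect-≤ z≤n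

  mirror : ∀ {i} → i ℕ.< n → ∃[ j ] j ℕ.< n × reflect n i ≡ suc j × reflect n (suc i) ≡ j × reflect n j ≡ suc i × reflect n (suc j) ≡ i
  mirror {i} i<n = j , j<n , ri , rsi , trans (cong (reflect n) (sym rsi)) (reflect-involutive n (suc i)) ,
    trans (cong (reflect n) (sym ri)) (reflect-involutive n i)
    where
    j = n ℕ.∸ suc i
    1+j : suc j ≡ n ℕ.∸ i
    1+j = sym (ℕ.+-∸-assoc 1 i<n)
    j<n = ℕ.≤-trans (ℕ.≤-reflexive 1+j) (ℕ.m∸n≤m n i)
    ri = trans (reflect-≤ (ℕ.<⇒≤ i<n)) (sym 1+j)
    rsi = reflect-≤ i<n

  to : ProperCycle n (w ∘ reflect n) → ProperCycle n w
  to (c , p) = (λ eq → c (trans (cong w at-n) (trans (sym eq) (cong w (sym at-0))))) , λ i i<n eq →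
    let j , j<n , _ , _ , rj , rsj = mirror i<n in
    p j j<n (trans (cong w rsj) (trans (sym eq) (cong w (sym rj))))

  from : ProperCycle n w → ProperCycle n (w ∘ reflect n)
  from (c , p) = (λ eq → c (trans (cong w (sym at-0)) (trans (sym eq) (cong w at-n)))) , λ i i<n eq →
    let j , j<n , ri , rsi , _ , _ = mirror i<n in
    p j j<n (trans (cong w (sym ri)) (trans (sym eq) (cong w rsi)))

-- The reflection i ↦ n - i preserves the cycle, exchanges 0 and n, and fixes `suc n`.
copy-first : ∀ n → suc n ⊢ (λ w → δ (suc n) 0 w * cycleFn n w) ≈ (λ w → copy n w * cycleFn n w)
copy-first n = ≈-trans
  (ext λ w → cong₂ _*_
    (cong₂ (λ a b → indicator (w a ℕ.≟ w b)) (sym (reflect-> {n} ℕ.≤-refl)) (sym (trans (reflect-≤ {n} ℕ.≤-refl) (ℕ.n∸n≡0 n))))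
    (sym (cycleFn-reflect n w)))
  (relabeled (reflect n) (reflect-involutive n) (λ i n<i → reflect-> n<i)
    (tie ℕ.≤-refl (ℕ.n≤1+n (suc n)) (Kernel-suc (cycleFn-kernel n))))

δ-trans : ∀ i j k w → δ i j w * δ i k w ≡ δ i j w * δ j k w
δ-trans i j k w = Ind-≡ (λ (ij , ik) → ij , trans (sym ij) ik) (λ (ij , jk) → ij , trans ij jk)
  (Ind-* (ind (w i ℕ.≟ w j)) (ind (w i ℕ.≟ w k))) (Ind-* (ind (w i ℕ.≟ w j)) (ind (w j ℕ.≟ w k)))

-- Deletion–contraction of the closing edge of the cycle
cycleFn-suc : ∀ n w → cycleFn (suc n) w ≡ pathFn (suc n) w + - (δ (suc n) 0 w * cycleFn n w)
cycleFn-suc n w = trans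
  (solve 3 (λ z t p → (con 1ℚ :+ :- z) :* ((con 1ℚ :+ :- t) :* p) := (con 1ℚ :+ :- t) :* p :+ :- ((z :- t :* z) :* p)) refl z t P)
  -- Here t z = t y = z y, since any two of the three equalities among the letters at `suc n`, `n`
  -- and 0 imply the third. Thus z (1 - t) becomes z (1 - y): contraction turns the edge to `n` into
  -- the closing edge of the smaller cycle.
  (trans (cong (λ y → (1ℚ + - t) * P + - ((z - y) * P)) (trans (δ-trans (suc n) n 0 w) absorb))
    (solve 4 (λ z t y p → (con 1ℚ :+ :- t) :* p :+ :- ((z :- z :* y) :* p) := (con 1ℚ :+ :- t) :* p :+ :- (z :* ((con 1ℚ :+ :- y) :* p))) refl z t y P))
  where
  z = δ (suc n) 0 w
  t = copy n w
  y = δ n 0 w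
  P = pathFn n w
  absorb : t * y ≡ z * y
  absorb = Ind-≡ (λ (a , b) → trans a b , b) (λ (a , b) → trans a (sym b) , b)
    (Ind-* (ind (w (suc n) ℕ.≟ w n)) (ind (w n ℕ.≟ w 0))) (Ind-* (ind (w (suc n) ℕ.≟ w 0)) (ind (w n ℕ.≟ w 0)))

path-cycle-combo : ∀ n → ∃[ P ] ∃[ C ] Combo n P C × (n ⊢ pathFn n ≈ P) × (n ⊢ cycleFn n ≈ C)
-- One vertex is a single block of size 1, whose weight `nat 0` matches the vanishing of the looped
-- cycle.
path-cycle-combo zero = _ , _ , term 1ℚ (ℚ.nonNegative⁻¹ 1ℚ) 0 0 [] ↭-refl ,
  (ext λ w → cong (λ a → 1ℚ * (a * 1ℚ)) (sym (distinct-singleton 0 w))) ,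
  (ext λ w → trans (cong (λ a → (1ℚ + - a) * 1ℚ) (indicator-yes (w 0 ℕ.≟ w 0) refl)) (sym (ℚ.*-zeroˡ (1ℚ * (distinct [ 0 ] w * 1ℚ)))))
path-cycle-combo (suc n) with path-cycle-combo n
... | P , C , s , p , q with step s
... | P′ , C′ , s′ , p′ , q′ = P′ , C′ , s′ , ≈-trans path≈ p′ ,
  ≈-trans (ext (cycleFn-suc n)) (≈-trans (≈-sub path≈ (≈-trans (copy-first n) (copy-cong q))) q′)
  where
  path≈ : suc n ⊢ pathFn (suc n) ≈ (λ w → P w + - (copy n w * P w))
  path≈ = ≈-trans (ext λ w → solve 2 (λ t p → (con 1ℚ :+ :- t) :* p := p :+ :- (t :* p)) refl (copy n w) (pathFn n w))
    (≈-sub (≈-suc p) (copy-cong p))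

-- Inclusion-exclusion over the two new edges. The term with both contracted vanishes, because it
-- would identify 0 and `n`, which the closing edge keeps apart.
tadpole-0 : ∀ n w → tadpoleFn n 0 w ≡ (cycleFn n w + - (copy n w * cycleFn n w)) + - (δ (suc n) 0 w * cycleFn n w)
tadpole-0 n w = trans
  (solve 4 (λ t z y p → (con 1ℚ :+ :- t) :* ((con 1ℚ :+ :- z) :* ((con 1ℚ :+ :- y) :* p))
    := (((con 1ℚ :+ :- y) :* p :+ :- (t :* ((con 1ℚ :+ :- y) :* p))) :+ :- (z :* ((con 1ℚ :+ :- y) :* p))) :+ (t :* z) :* ((con 1ℚ :+ :- y) :* p)) refl t z y P)
  (trans (cong (R +_) (trans (cong (_* ((1ℚ + - y) * P)) (δ-trans (suc n) n 0 w))
      (trans (solve 3 (λ t y p → (t :* y) :* ((con 1ℚ :+ :- y) :* p) := (t :* p) :* (y :- y :* y)) refl t y P)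
        (trans (cong (λ a → (t * P) * (y - a)) idempotent) (solve 2 (λ a y → a :* (y :- y) := con 0ℚ) refl (t * P) y)))))
    (ℚ.+-identityʳ R))
  where
  z = δ (suc n) 0 w
  t = copy n w
  y = δ n 0 w
  P = pathFn n w
  R = (cycleFn n w + - (t * cycleFn n w)) + - (z * cycleFn n w)
  idempotent : y * y ≡ y
  idempotent = Ind-≡ proj₁ (λ a → a , a) (Ind-* (ind (w n ℕ.≟ w 0)) (ind (w n ℕ.≟ w 0))) (ind (w n ℕ.≟ w 0))

-- Every nonnegative combination in normal form has a weighted partner, so `step` appends path
-- vertices even though that partner is no longer a cycle function.
tadpole-combo : ∀ n l → ∃[ P ] ∃[ C ] Combo (suc (l ℕ.+ n)) P C × (suc (l ℕ.+ n) ⊢ tadpoleFn n l ≈ P)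
tadpole-combo n zero with path-cycle-combo n
... | P , C , s , _ , q with attach s
... | P′ , C′ , s′ , p′ = P′ , C′ , s′ , ≈-trans (ext (tadpole-0 n)) (≈-trans
  (≈-sub (≈-sub (≈-suc q) (copy-cong q)) (≈-trans (copy-first n) (copy-cong q)))
  (≈-trans (ext λ w → solve 2 (λ c t → (c :+ :- (t :* c)) :+ :- (t :* c) := c :+ :- (con two :* (t :* c))) refl (C w) (copy n w)) p′))
tadpole-combo n (suc l) with tadpole-combo n l
... | P , C , s , p with step s
... | P′ , C′ , s′ , p′ , _ = P′ , C′ , s′ , ≈-trans
  (ext λ w → solve 2 (λ t p → (con 1ℚ :+ :- t) :* p := p :+ :- (t :* p)) refl (copy (suc (l ℕ.+ n)) w) (tadpoleFn n l w))
  (≈-trans (≈-sub (≈-suc p) (copy-cong p)) p′)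

-- Finite words as infinite ones

extend : ∀ {d} → Word d → ℕ → ℕ
extend {zero}  w i       = 0
extend {suc d} w zero    = w zero
extend {suc d} w (suc i) = extend (w ∘ suc) i

extend-toℕ : ∀ {d} (w : Word d) i → extend w (toℕ i) ≡ w i
extend-toℕ w zero    = refl
extend-toℕ w (suc i) = extend-toℕ (w ∘ suc) i

extend-< : ∀ {d} (w : Word d) {i} (i<d : i ℕ.< d) → extend w i ≡ w (fromℕ< i<d)
extend-< w i<d = trans (cong (extend w) (sym (Fin.toℕ-fromℕ< i<d))) (extend-toℕ w (fromℕ< i<d))

-- Set partitions from lists of blocks

Unique-++ˡ : ∀ {A : Set} (xs {ys} : List A) → Unique (xs ++ ys) → Unique xs
Unique-++ˡ []       u       = []
Unique-++ˡ (x ∷ xs) (p ∷ u) = All.++⁻ˡ xs p ∷ Unique-++ˡ xs u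

Unique-++ʳ : ∀ {A : Set} (xs {ys} : List A) → Unique (xs ++ ys) → Unique ys
Unique-++ʳ []       u       = u
Unique-++ʳ (x ∷ xs) (p ∷ u) = Unique-++ʳ xs u

Unique-++-disjoint : ∀ {A : Set} (xs {ys} : List A) {x} → Unique (xs ++ ys) → x ∈ xs → ¬ x ∈ ys
Unique-++-disjoint (x ∷ xs) (p ∷ u) (here refl) x∈ys = All.lookup (All.++⁻ʳ xs p) x∈ys refl
Unique-++-disjoint (x ∷ xs) (p ∷ u) (there x∈)  x∈ys = Unique-++-disjoint xs u x∈ x∈ys

Unique-concat-block : ∀ {A : Set} {xss : List (List A)} {xs} → Unique (concat xss) → xs ∈ xss → Unique xs
Unique-concat-block {xss = xs ∷ _} u (here refl) = Unique-++ˡ xs u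
Unique-concat-block {xss = xs ∷ _} u (there p)   = Unique-concat-block (Unique-++ʳ xs u) p

Unique-map-on : ∀ {A B : Set} {f : A → B} {xs} → Unique xs →
  (∀ {x y} → x ∈ xs → y ∈ xs → f x ≡ f y → x ≡ y) → Unique (map f xs)
Unique-map-on []      _   = []
Unique-map-on (p ∷ u) inj =
  All.map⁺ (All.tabulate λ y∈ eq → All.lookup p y∈ (inj (here refl) (there y∈) eq)) ∷
  Unique-map-on u (λ x∈ y∈ → inj (there x∈) (there y∈))

Unique-map⇒injective : ∀ {A B : Set} {f : A → B} {xs x y} → Unique (map f xs) → x ∈ xs → y ∈ xs → f x ≡ f y → x ≡ y
Unique-map⇒injective _ (here refl) (here refl) _ = refl
Unique-map⇒injective {f = f} (p ∷ u) (here refl) (there y∈) eq = contradiction eq (All.lookup p (∈-map⁺ f y∈))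
Unique-map⇒injective {f = f} (p ∷ u) (there x∈) (here refl) eq = contradiction (sym eq) (All.lookup p (∈-map⁺ f x∈))
Unique-map⇒injective (p ∷ u) (there x∈) (there y∈) eq = Unique-map⇒injective u x∈ y∈ eq

-- When `concat BB` has no repetition this is a partial equivalence relation whose classes are the
-- nonempty blocks; transitivity is where disjointness enters.
Together : List (List ℕ) → ℕ → ℕ → Set
Together BB i j = Any (λ A → i ∈ A × j ∈ A) BB

together? : ∀ BB i j → Dec (Together BB i j)
together? BB i j = Any.any? (λ A → i ∈? A ×-dec j ∈? A) BB

Together-∈ : ∀ {BB i j} → Together BB i j → i ∈ concat BB × j ∈ concat BB
Together-∈ {A ∷ BB} (here (i∈ , j∈)) = ∈-++⁺ˡ i∈ , ∈-++⁺ˡ j∈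
Together-∈ {A ∷ BB} (there t) with Together-∈ t
... | i∈ , j∈ = ∈-++⁺ʳ A i∈ , ∈-++⁺ʳ A j∈

Together-refl : ∀ {BB i} → i ∈ concat BB → Together BB i i
Together-refl {BB} i∈ = Any.map (λ i∈A → i∈A , i∈A) (∈-concat⁻ BB i∈)

Together-sym : ∀ {BB i j} → Together BB i j → Together BB j i
Together-sym = Any.map λ (i∈ , j∈) → j∈ , i∈

Together-trans : ∀ {BB i j k} → Unique (concat BB) → Together BB i j → Together BB j k → Together BB i k
Together-trans u (here (i∈ , _)) (here (_ , k∈)) = here (i∈ , k∈)
Together-trans {A ∷ BB} u (here (_ , j∈)) (there t) = contradiction (proj₁ (Together-∈ t)) (Unique-++-disjoint A u j∈)
Together-trans {A ∷ BB} u (there t) (here (j∈ , _)) = contradiction (proj₂ (Together-∈ t)) (Unique-++-disjoint A u j∈)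
Together-trans {A ∷ BB} u (there s) (there t) = there (Together-trans (Unique-++ʳ A u) s t)

prod-ind : ∀ CC w → Ind (All (λ A → Unique (map w A)) CC) (prod distinct CC w)
prod-ind []       w = holds []
prod-ind (A ∷ CC) w = Ind-⇔ (λ (u , us) → u ∷ us) (λ { (u ∷ us) → u , us }) (Ind-* (ind (unique? (map w A))) (prod-ind CC w))

module FromBlocks {d} (BB : List (List ℕ)) (p : concat BB ↭ downFrom d) where

  private
    B : Vec (Subset d) d
    B = tabulate λ i → tabulate λ j → does (together? BB (toℕ i) (toℕ j))

    lookup-B : ∀ i → lookup B i ≡ tabulate λ j → does (together? BB (toℕ i) (toℕ j))
    lookup-B = Vec.lookup∘tabulate _

    lookup-B₂ : ∀ i j → lookup (lookup B i) j ≡ does (together? BB (toℕ i) (toℕ j))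
    lookup-B₂ i j = trans (cong (λ v → lookup v j) (lookup-B i)) (Vec.lookup∘tabulate _ j)

    unique : Unique (concat BB)
    unique = Permₛ.Unique-resp-↭ (setoid ℕ) (↭⇒↭ₛ (↭-sym p)) (Unique.downFrom⁺ d)

    ∈-block⁺ : ∀ {i j} → Together BB (toℕ i) (toℕ j) → j ∈ˢ lookup B i
    ∈-block⁺ {i} {j} t = Vec.lookup⇒[]= j _ (trans (lookup-B₂ i j) (dec-true (together? BB (toℕ i) (toℕ j)) t))

    ∈-block⁻ : ∀ {i j} → j ∈ˢ lookup B i → Together BB (toℕ i) (toℕ j)
    ∈-block⁻ {i} {j} j∈ = witness (together? BB (toℕ i) (toℕ j)) (trans (sym (lookup-B₂ i j)) (Vec.[]=⇒lookup j∈))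
      where
      witness : ∀ {P : Set} (P? : Dec P) → does P? ≡ true → P
      witness (yes p) _ = p

    isPart : IsPartition B
    isPart = (λ i → ∈-block⁺ (Together-refl {BB} (↭.∈-resp-↭ (↭-sym p) (∈-downFrom⁺ (Fin.toℕ<n i))))) ,
      λ i j j∈ → trans (lookup-B j) (trans
        (Vec.tabulate-cong λ k → does-⇔ (mk⇔ (Together-trans unique (∈-block⁻ j∈)) (Together-trans unique (Together-sym (∈-block⁻ j∈))))
          (together? BB (toℕ j) (toℕ k)) (together? BB (toℕ i) (toℕ k)))
        (sym (lookup-B i)))

  fromBlocks : SetPartition d
  fromBlocks = ⟨ B , isPart ⟩

  e-fromBlocks : ∀ w → e fromBlocks w ≡ prod distinct BB (extend w)
  e-fromBlocks w = Ind-≡ to from (ind (distinctOnBlocks? fromBlocks w)) (prod-ind BB (extend w))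
    where
    to : DistinctOnBlocks fromBlocks w → All (λ A → Unique (map (extend w) A)) BB
    to dist = All.tabulate λ {A} A∈BB → Unique-map-on (Unique-concat-block unique A∈BB) λ {x} {y} x∈A y∈A eq →
      injective (together (bound A∈BB x∈A) (bound A∈BB y∈A) (Any.map (λ { refl → x∈A , y∈A }) A∈BB)) eq
      where
      bound : ∀ {A x} → A ∈ BB → x ∈ A → x ℕ.< d
      bound A∈BB x∈A = ∈-downFrom⁻ (↭.∈-resp-↭ p (∈-concat⁺′ x∈A A∈BB))

      -- Packaging the indices with their equations lets `injective` match on `refl` and work with
      -- elements of `Fin d`.
      together : ∀ {x y} (x<d : x ℕ.< d) (y<d : y ℕ.< d) → Together BB x y →
        ∃[ i ] ∃[ j ] toℕ i ≡ x × toℕ j ≡ y × j ∈ˢ block fromBlocks i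
      together x<d y<d t = fromℕ< x<d , fromℕ< y<d , Fin.toℕ-fromℕ< x<d , Fin.toℕ-fromℕ< y<d ,
        ∈-block⁺ (subst₂ (Together BB) (sym (Fin.toℕ-fromℕ< x<d)) (sym (Fin.toℕ-fromℕ< y<d)) t)

      injective : ∀ {x y} → (∃[ i ] ∃[ j ] toℕ i ≡ x × toℕ j ≡ y × j ∈ˢ block fromBlocks i) → extend w x ≡ extend w y → x ≡ y
      injective (i , j , refl , refl , j∈) eq with i Fin.≟ j
      ... | yes refl = refl
      ... | no i≢j   = contradiction (trans (sym (extend-toℕ w i)) (trans eq (extend-toℕ w j))) (dist i j i≢j j∈)

    from : All (λ A → Unique (map (extend w) A)) BB → DistinctOnBlocks fromBlocks w
    from us j k j≢k k∈ wj≡wk = go us (∈-block⁻ k∈)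
      where
      go : ∀ {CC} → All (λ A → Unique (map (extend w) A)) CC → ¬ Together CC (toℕ j) (toℕ k)
      go (u ∷ us) (here (j∈ , k∈)) = j≢k (Fin.toℕ-injective (Unique-map⇒injective u j∈ k∈
        (trans (extend-toℕ w j) (trans wj≡wk (sym (extend-toℕ w k))))))
      go (u ∷ us) (there t) = go us t

open FromBlocks using (fromBlocks; e-fromBlocks)

-- From congruences to class sums

Null : ∀ {d} → Series d → Set
Null F = Expands F (λ _ → 0ℚ)

Null-cong : ∀ {d} {F G : Series d} → (∀ w → F w ≡ G w) → Null F → Null G
Null-cong eq = Expands-cong eq λ _ → refl

Null-+ : ∀ {d} {F G : Series d} → Null F → Null G → Null (λ w → F w + G w)
Null-+ f g = Expands-+ f g

Null-* : ∀ {d} a {F : Series d} → Null F → Null (λ w → a * F w)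
Null-* a {F} f = Expands-cong {F = λ w → a * F w} (λ _ → refl) (λ _ → ℚ.*-zeroʳ a) (Expands-* a f)

-- On a basis element, relabeling yields `e` of an equivalent partition, so the two class indicators
-- cancel; the other cases follow by linearity.
Null-relabel : ∀ {n F} → Span distinct (downFrom (suc n)) F →
  (t : Fin (suc n) → Fin (suc n)) → Involutive t → t (fromℕ n) ≡ fromℕ n →
  Null {suc n} (λ w → F (extend (w ∘ t)) + - F (extend w))
Null-relabel (basis BB p) t inv fix = Expands-cong
  (λ w → cong₂ (λ a b → a + b) (trans (e-relabel σ w) (e-fromBlocks BB p (w ∘ t)))
    (trans (solve 1 (λ a → con (- 1ℚ) :* a := :- a) refl (e σ w)) (cong -_ (e-fromBlocks BB p w))))
  (λ π → trans (cong (_+ - 1ℚ * indicator (π ≋? σ)) (indicator-⇔ (π ≋? relabel σ) (π ≋? σ)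
      (λ (a , b) → trans a (proj₁ σ′≋σ) , trans b (proj₂ σ′≋σ))
      (λ (a , b) → trans a (sym (proj₁ σ′≋σ)) , trans b (sym (proj₂ σ′≋σ)))))
    (solve 1 (λ a → a :+ con (- 1ℚ) :* a := con 0ℚ) refl (indicator (π ≋? σ))))
  (Expands-+ (Expands-e (relabel σ)) (Expands-* (- 1ℚ) (Expands-e σ)))
  where
  open Relabel t inv
  σ = fromBlocks BB p
  σ′≋σ = relabel-≋ t inv fix σ
Null-relabel (add {F} {G} f g) t inv fix = Null-cong
  (λ w → solve 4 (λ a b c d → (a :+ :- b) :+ (c :+ :- d) := (a :+ c) :+ :- (b :+ d)) refl
    (F (extend (w ∘ t))) (F (extend w)) (G (extend (w ∘ t))) (G (extend w)))
  (Null-+ (Null-relabel f t inv fix) (Null-relabel g t inv fix))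
Null-relabel (scale c {F} f) t inv fix = Null-cong
  (λ w → solve 3 (λ c a b → c :* (a :+ :- b) := c :* a :+ :- (c :* b)) refl c (F (extend (w ∘ t))) (F (extend w)))
  (Null-* c (Null-relabel f t inv fix))
Null-relabel (ext eq f) t inv fix = Null-cong
  (λ w → cong₂ (λ a b → a + - b) (eq (extend (w ∘ t))) (eq (extend w))) (Null-relabel f t inv fix)

module Restrict {n} (τ : ℕ → ℕ) (inv : Involutive τ) (fix : ∀ i → n ℕ.≤ i → τ i ≡ i) where

  τ-< : ∀ {i} → i ℕ.< suc n → τ i ℕ.< suc n
  -- If `τ i` exceeded n it would be fixed, whence `τ i = τ (τ i) = i`, contrary to i ≤ n.
  τ-< {i} i≤n = ℕ.≰⇒> λ n<τi → ℕ.<-irrefl refl (ℕ.<-≤-trans n<τi (ℕ.≤-trans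
    (ℕ.≤-reflexive (trans (sym (fix (τ i) (ℕ.<⇒≤ n<τi))) (inv i))) (ℕ.≤-pred i≤n))) 

  t : Fin (suc n) → Fin (suc n)
  t i = fromℕ< (τ-< (Fin.toℕ<n i))

  toℕ-t : ∀ i → toℕ (t i) ≡ τ (toℕ i)
  toℕ-t i = Fin.toℕ-fromℕ< (τ-< (Fin.toℕ<n i))

  t-involutive : Involutive t
  t-involutive i = Fin.toℕ-injective (trans (toℕ-t (t i)) (trans (cong τ (toℕ-t i)) (inv (toℕ i))))

  t-fix : t (fromℕ n) ≡ fromℕ n
  t-fix = Fin.toℕ-injective (trans (toℕ-t (fromℕ n)) (fix (toℕ (fromℕ n)) (ℕ.≤-reflexive (sym (Fin.toℕ-fromℕ n)))))

  extend-t : ∀ w i → i ℕ.< suc n → extend (w ∘ t) i ≡ extend w (τ i)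
  extend-t w i i<d = trans (extend-< (w ∘ t) i<d) (trans (sym (extend-toℕ w (t (fromℕ< i<d))))
    (cong (extend w) (trans (toℕ-t (fromℕ< i<d)) (cong τ (Fin.toℕ-fromℕ< i<d)))))

≈-Null : ∀ {n F G} → n ⊢ F ≈ G → Null {suc n} (λ w → F (extend w) + - G (extend w))
≈-Null (ext {F} {G} eq) = Null-cong
  (λ w → sym (trans (cong (λ a → F (extend w) + - a) (sym (eq (extend w)))) (ℚ.+-inverseʳ (F (extend w))))) Expands-0
≈-Null (≈-sym {F} {G} p) = Null-cong
  (λ w → solve 2 (λ a b → con (- 1ℚ) :* (a :+ :- b) := b :+ :- a) refl (F (extend w)) (G (extend w))) (Null-* (- 1ℚ) (≈-Null p))
≈-Null (≈-trans {F} {G} {H} p q) = Null-cong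
  (λ w → solve 3 (λ a b c → (a :+ :- b) :+ (b :+ :- c) := a :+ :- c) refl (F (extend w)) (G (extend w)) (H (extend w)))
  (Null-+ (≈-Null p) (≈-Null q))
≈-Null (add {F} {F′} {G} {G′} p q) = Null-cong
  (λ w → solve 4 (λ a b c d → (a :+ :- b) :+ (c :+ :- d) := (a :+ c) :+ :- (b :+ d)) refl
    (F (extend w)) (F′ (extend w)) (G (extend w)) (G′ (extend w)))
  (Null-+ (≈-Null p) (≈-Null q))
≈-Null (scale c {F} {G} p) = Null-cong
  (λ w → solve 3 (λ c a b → c :* (a :+ :- b) := c :* a :+ :- (c :* b)) refl c (F (extend w)) (G (extend w)))
  (Null-* c (≈-Null p))
≈-Null {n} (relabeled {F} τ inv fix f) = Null-cong
  -- `t` and `τ` are compared on positions up to n, and `F` reads only those.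
  (λ w → cong (_+ - F (extend w)) (Kernel-local f (extend-t w)))
  (Null-relabel (Span-equal⇒distinct (Kernel-span f)) t t-involutive t-fix)
  where open Restrict τ inv fix

0≤indicator : ∀ {P : Set} (P? : Dec P) → 0ℚ ≤ indicator P?
0≤indicator (yes _) = ℚ.nonNegative⁻¹ 1ℚ
0≤indicator (no _)  = ℚ.≤-refl

Combo-expands : ∀ {n P C} → Combo n P C → ∃[ φ ] Expands {suc n} (λ w → P (extend w)) φ × (∀ π → 0ℚ ≤ φ π)
Combo-expands (term c 0≤c a k BB p) = _ ,
  Expands-cong (λ w → cong (c *_) (e-fromBlocks (run k (suc a) ∷ BB) blocks↭ w)) (λ _ → refl) (Expands-* c (Expands-e σ)) ,
  λ π → *-nonNeg 0≤c (0≤indicator (π ≋? σ))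
  where
  blocks↭ = run-↭ BB k (suc a) p
  σ = fromBlocks (run k (suc a) ∷ BB) blocks↭
Combo-expands (s ⊞ s′) with Combo-expands s | Combo-expands s′
... | φ , f , f≥0 | ψ , g , g≥0 = _ , Expands-+ f g , λ π → ℚ.+-mono-≤ (f≥0 π) (g≥0 π)

-- Write F = P + (F - P): the first summand has nonnegative class sums and the second has class sums
-- 0.
≈-Combo⇒EPositive : ∀ {n F P C} (G : Graph (suc n)) → (∀ w → Y G w ≡ F (extend w)) → n ⊢ F ≈ P → Combo n P C → EPositive G
≈-Combo⇒EPositive {F = F} {P} G YG F≈P s with Combo-expands s
... | φ , f , f≥0 with Expands-+ f (≈-Null F≈P)
... | c , exp , cls = c ,
  (λ w → trans (YG w) (trans (solve 2 (λ a b → a := b :+ (a :+ :- b)) refl (F (extend w)) (P (extend w))) (exp w))) ,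
  λ π → subst (0ℚ ≤_) (sym (trans (cls π) (ℚ.+-identityʳ (φ π)))) (f≥0 π)

-- The edges of the line graph of the tadpole

-- One orientation per edge, larger endpoint first, in correspondence with the factors of
-- `tadpoleFn`.
data Edge (n l : ℕ) : ℕ → ℕ → Set where
  along-cycle : ∀ {i} → i ℕ.< n → Edge n l (suc i) i
  closing     : Edge n l n 0
  to-last     : Edge n l (suc n) n
  to-first    : Edge n l (suc n) 0
  along-path  : ∀ {i} → i ℕ.< l → Edge n l (suc (suc (i ℕ.+ n))) (suc (i ℕ.+ n))

ProperTadpole : ℕ → ℕ → (ℕ → ℕ) → Set
ProperTadpole n l w = ∀ {i j} → Edge n l i j → w i ≢ w j

tadpoleFn-ind : ∀ n l w → Ind (ProperTadpole n l w) (tadpoleFn n l w)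
tadpoleFn-ind n zero w = Ind-⇔
  (λ { (last , first , close , path) → λ
    { (along-cycle i<n) → path _ i<n ; closing → close ; to-last → last ; to-first → first } })
  (λ p → p to-last , p to-first , p closing , λ i i<n → p (along-cycle i<n))
  (Ind-* (Ind-untie (suc n) n w) (Ind-* (Ind-untie (suc n) 0 w) (cycleFn-ind n w)))
tadpoleFn-ind n (suc l) w = Ind-⇔ to from (Ind-* (Ind-untie (suc (suc (l ℕ.+ n))) (suc (l ℕ.+ n)) w) (tadpoleFn-ind n l w))
  where
  to : (w (suc (suc (l ℕ.+ n))) ≢ w (suc (l ℕ.+ n))) × ProperTadpole n l w → ProperTadpole n (suc l) w
  to (_ , p) (along-cycle i<n) = p (along-cycle i<n)
  to (_ , p) closing           = p closing
  to (_ , p) to-last           = p to-last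
  to (_ , p) to-first          = p to-first
  to (end , p) (along-path (s≤s i≤l)) with ℕ.m≤n⇒m<n∨m≡n i≤l
  ... | inj₁ i<l  = p (along-path i<l)
  ... | inj₂ refl = end

  weaken : ∀ {i j} → Edge n l i j → Edge n (suc l) i j
  weaken (along-cycle i<n) = along-cycle i<n
  weaken closing           = closing
  weaken to-last           = to-last
  weaken to-first          = to-first
  weaken (along-path i<l)  = along-path (ℕ.m<n⇒m<1+n i<l)

  from : ProperTadpole n (suc l) w → (w (suc (suc (l ℕ.+ n))) ≢ w (suc (l ℕ.+ n))) × ProperTadpole n l w
  from p = p (along-path ℕ.≤-refl) , λ ed → p (weaken ed)

module LineTadpole (n l : ℕ) (0<n : 0 ℕ.< n) where

  G = lineTadpole (suc n) (suc l)

  V = Fin (suc n ℕ.+ suc l)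

  Adj⇒Edge : ∀ u v → Adj G u v → Edge n l (toℕ u) (toℕ v) ⊎ Edge n l (toℕ v) (toℕ u)
  Adj⇒Edge u v (inj₁ a) with splitAt (suc n) u in equ | splitAt (suc n) v in eqv
  Adj⇒Edge u v (inj₁ (inj₁ c)) | inj₁ a | inj₁ b =
    subst₂ (λ i j → Edge n l i j ⊎ Edge n l j i) (lower equ) (lower eqv) (cycle-edge c)
    where
    lower : ∀ {u a} → splitAt (suc n) u ≡ inj₁ a → toℕ a ≡ toℕ u
    lower {u} {a} eq = trans (sym (Fin.toℕ-↑ˡ a (suc l))) (cong toℕ (Fin.splitAt⁻¹-↑ˡ eq))

    path-edge : ∀ {a b : Fin (suc n)} → suc (suc (toℕ a)) ≡ suc (toℕ b) → Edge n l (toℕ b) (toℕ a)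
    path-edge {a} {b} eq = subst (λ i → Edge n l i (toℕ a)) (ℕ.suc-injective eq)
      (along-cycle (ℕ.≤-trans (ℕ.≤-reflexive (ℕ.suc-injective eq)) (ℕ.≤-pred (Fin.toℕ<n b))))

    closing-edge : ∀ {a b : Fin (suc n)} → suc (toℕ a) ≡ suc n → suc (toℕ b) ≡ 1 → Edge n l (toℕ a) (toℕ b)
    closing-edge eq eq′ = subst₂ (Edge n l) (sym (ℕ.suc-injective eq)) (sym (ℕ.suc-injective eq′)) closing

    cycle-edge : ∀ {a b : Fin (suc n)} → Adj (cycle (suc n)) a b → Edge n l (toℕ a) (toℕ b) ⊎ Edge n l (toℕ b) (toℕ a)
    cycle-edge {a} {b} (inj₁ (_ , inj₁ eq)) = inj₂ (path-edge {a} {b} eq)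
    cycle-edge {a} {b} (inj₁ (_ , inj₂ eq)) = inj₁ (path-edge {b} {a} eq)
    cycle-edge {a} {b} (inj₂ (_ , inj₁ (eq , eq′))) = inj₁ (closing-edge {a} {b} eq eq′)
    cycle-edge {a} {b} (inj₂ (_ , inj₂ (eq , eq′))) = inj₂ (closing-edge {b} {a} eq eq′)
  Adj⇒Edge u v (inj₁ (inj₂ c)) | inj₂ a | inj₂ b =
    subst₂ (λ i j → Edge n l i j ⊎ Edge n l j i) (upper equ) (upper eqv) (path-edges c)
    where
    upper : ∀ {u b} → splitAt (suc n) u ≡ inj₂ b → suc (toℕ b ℕ.+ n) ≡ toℕ u
    upper {u} {b} eq = trans (cong suc (ℕ.+-comm (toℕ b) n))
      (trans (sym (Fin.toℕ-↑ʳ (suc n) b)) (cong toℕ (Fin.splitAt⁻¹-↑ʳ eq)))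

    path-edge : ∀ {a b : Fin (suc l)} → suc (suc (toℕ a)) ≡ suc (toℕ b) → Edge n l (suc (toℕ b ℕ.+ n)) (suc (toℕ a ℕ.+ n))
    path-edge {a} {b} eq = subst (λ i → Edge n l (suc (i ℕ.+ n)) (suc (toℕ a ℕ.+ n))) (ℕ.suc-injective eq)
      (along-path (ℕ.≤-trans (ℕ.≤-reflexive (ℕ.suc-injective eq)) (ℕ.≤-pred (Fin.toℕ<n b))))

    path-edges : ∀ {a b : Fin (suc l)} → Adj (path (suc l)) a b →
      Edge n l (suc (toℕ a ℕ.+ n)) (suc (toℕ b ℕ.+ n)) ⊎ Edge n l (suc (toℕ b ℕ.+ n)) (suc (toℕ a ℕ.+ n))
    path-edges {a} {b} (_ , inj₁ eq) = inj₂ (path-edge {a} {b} eq)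
    path-edges {a} {b} (_ , inj₂ eq) = inj₁ (path-edge {b} {a} eq)
  Adj⇒Edge u v (inj₂ a) = attaching-edges a
    where
    first : ∀ {u v : V} → suc (toℕ u) ≡ 1 → suc (toℕ v) ≡ suc n ℕ.+ 1 → Edge n l (toℕ v) (toℕ u)
    first eq eq′ = subst₂ (Edge n l) (sym (trans (ℕ.suc-injective eq′) (ℕ.+-comm n 1))) (sym (ℕ.suc-injective eq)) to-first

    last : ∀ {u v : V} → suc (toℕ u) ≡ suc n → suc (toℕ v) ≡ suc n ℕ.+ 1 → Edge n l (toℕ v) (toℕ u)
    last eq eq′ = subst₂ (Edge n l) (sym (trans (ℕ.suc-injective eq′) (ℕ.+-comm n 1))) (sym (ℕ.suc-injective eq)) to-last

    attaching-edges : Adj (edge 1 (suc n ℕ.+ 1) ∪ edge (suc n) (suc n ℕ.+ 1)) u v → Edge n l (toℕ u) (toℕ v) ⊎ Edge n l (toℕ v) (toℕ u)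
    attaching-edges (inj₁ (_ , inj₁ (eq , eq′))) = inj₂ (first {u} {v} eq eq′)
    attaching-edges (inj₁ (_ , inj₂ (eq , eq′))) = inj₁ (first {v} {u} eq eq′)
    attaching-edges (inj₂ (_ , inj₁ (eq , eq′))) = inj₂ (last {u} {v} eq eq′)
    attaching-edges (inj₂ (_ , inj₂ (eq , eq′))) = inj₁ (last {v} {u} eq eq′)

  ≢-by-toℕ : ∀ {k} {a b : Fin k} {i j} → toℕ a ≡ i → toℕ b ≡ j → i ≢ j → a ≢ b
  ≢-by-toℕ refl refl i≢j refl = i≢j refl

  Edge⇒Adj : ∀ {i j} → Edge n l i j → ∃[ u ] ∃[ v ] Adj G u v × toℕ u ≡ i × toℕ v ≡ j
  Edge⇒Adj = λ
    { (along-cycle {i} i<n) →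
        let i<m = ℕ.m<n⇒m<1+n i<n
            a = fromℕ< (s≤s i<n) ; b = fromℕ< i<m
            a≡ = Fin.toℕ-fromℕ< (s≤s i<n) ; b≡ = Fin.toℕ-fromℕ< i<m
        in a ↑ˡ suc l , b ↑ˡ suc l ,
           low a b (inj₁ (≢-by-toℕ a≡ b≡ ℕ.1+n≢n , inj₂ (cong suc (trans (cong suc b≡) (sym a≡))))) ,
           trans (Fin.toℕ-↑ˡ a (suc l)) a≡ , trans (Fin.toℕ-↑ˡ b (suc l)) b≡
    ; closing →
        fromℕ n ↑ˡ suc l , zero ,
        -- `0<n` separates the endpoints of the closing edge, as adjacency in a simple graph
        -- demands.
        low (fromℕ n) zero (inj₂ (≢-by-toℕ (Fin.toℕ-fromℕ n) refl (ℕ.>⇒≢ 0<n) , inj₁ (cong suc (Fin.toℕ-fromℕ n) , refl))) ,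
        trans (Fin.toℕ-↑ˡ (fromℕ n) (suc l)) (Fin.toℕ-fromℕ n) , refl
    ; to-last →
        pendant , fromℕ n ↑ˡ suc l ,
        inj₂ (inj₂ (≢-by-toℕ pendant≡ last≡ ℕ.1+n≢n , inj₂ (cong suc last≡ , pendant-label))) ,
        pendant≡ , last≡
    ; to-first →
        pendant , zero ,
        inj₂ (inj₁ (≢-by-toℕ pendant≡ refl (λ ()) , inj₂ (refl , pendant-label))) ,
        pendant≡ , refl
    ; (along-path {i} i<l) →
        let i<m = ℕ.m<n⇒m<1+n i<l
            a = fromℕ< (s≤s i<l) ; b = fromℕ< i<m
            a≡ = Fin.toℕ-fromℕ< (s≤s i<l) ; b≡ = Fin.toℕ-fromℕ< i<m
        in suc n ↑ʳ a , suc n ↑ʳ b ,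
           high a b (≢-by-toℕ a≡ b≡ ℕ.1+n≢n , inj₂ (cong suc (trans (cong suc b≡) (sym a≡)))) ,
           trans (Fin.toℕ-↑ʳ (suc n) a) (cong suc (trans (cong (n ℕ.+_) a≡) (ℕ.+-comm n (suc i)))) ,
           trans (Fin.toℕ-↑ʳ (suc n) b) (cong suc (trans (cong (n ℕ.+_) b≡) (ℕ.+-comm n i)))
    }
    where
    low : ∀ a b → Adj (cycle (suc n)) a b → Adj G (a ↑ˡ suc l) (b ↑ˡ suc l)
    low a b adj = inj₁ (subst₂ (Pointwise (Adj (cycle (suc n))) (Adj (path (suc l))))
      (sym (Fin.splitAt-↑ˡ (suc n) a (suc l))) (sym (Fin.splitAt-↑ˡ (suc n) b (suc l))) (inj₁ adj))

    high : ∀ a b → Adj (path (suc l)) a b → Adj G (suc n ↑ʳ a) (suc n ↑ʳ b)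
    high a b adj = inj₁ (subst₂ (Pointwise (Adj (cycle (suc n))) (Adj (path (suc l))))
      (sym (Fin.splitAt-↑ʳ (suc n) (suc l) a)) (sym (Fin.splitAt-↑ʳ (suc n) (suc l) b)) (inj₂ adj))

    pendant : V
    pendant = suc n ↑ʳ zero

    pendant≡ : toℕ pendant ≡ suc n
    pendant≡ = trans (Fin.toℕ-↑ʳ (suc n) (zero {l})) (ℕ.+-identityʳ (suc n))

    pendant-label : suc (toℕ pendant) ≡ suc n ℕ.+ 1
    pendant-label = trans (cong suc pendant≡) (ℕ.+-comm 1 (suc n))

    last≡ : toℕ (fromℕ n ↑ˡ suc l) ≡ n
    last≡ = trans (Fin.toℕ-↑ˡ (fromℕ n) (suc l)) (Fin.toℕ-fromℕ n)

  Y-tadpole : ∀ w → Y G w ≡ tadpoleFn n l (extend w)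
  Y-tadpole w = Ind-≡ to from (ind (proper? G w)) (tadpoleFn-ind n l (extend w))
    where
    to : Proper G w → ProperTadpole n l (extend w)
    to proper ed eq with Edge⇒Adj ed
    ... | u , v , adj , refl , refl = proper u v adj (trans (sym (extend-toℕ w u)) (trans eq (extend-toℕ w v)))

    from : ProperTadpole n l (extend w) → Proper G w
    from proper u v adj eq = [ (λ ed → proper ed eq′) , (λ ed → proper ed (sym eq′)) ]′ (Adj⇒Edge u v adj)
      where
      eq′ : extend w (toℕ u) ≡ extend w (toℕ v)
      eq′ = trans (extend-toℕ w u) (trans eq (sym (extend-toℕ w v)))

theorem3p3 : (m l : ℕ) → m ≥ 3 → l ≥ 1 → EPositive (lineTadpole m l)
theorem3p3 (suc n) (suc l) (s≤s 2≤n) _ =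
  -- The graph has `suc (n + suc l)` vertices, so its last position is `n + suc l`, while the
  -- induction counts it as `suc l + n`.
  let P , C , s , F≈P = subst (λ k → ∃[ P ] ∃[ C ] Combo k P C × (k ⊢ tadpoleFn n l ≈ P)) (ℕ.+-comm (suc l) n) (tadpole-combo n l)
  in ≈-Combo⇒EPositive G Y-tadpole F≈P s
  where open LineTadpole n l (ℕ.≤-trans (s≤s z≤n) 2≤n)
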